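{- The worst-case approximation ratio of the grammar-based compressor RePair on words over a binary alphabet satisfies $$\alpha_{\mathrm{RePair}}(2,n)\in\Omega\left(\frac{\log n}{\log\log n}\right).$$
   Context: A straight-line program (SLP) over a finite alphabet $\Sigma$ is a context-free grammar $\mathbb{A}=(N,\Sigma,P,S)$ with a finite set $N$ of nonterminals ($N\cap\Sigma=\emptyset$), start nonterminal $S\in N$, and a finite set $P$ of productions $A\to w$ with $A\in N$, $w\in(N\cup\Sigma)^+$, such that (i) for every $A\in N$ there is exactly one production with left-hand side $A$, and (ii) the relation $\{(A,B)\in N\times N \mid (A\to w)\in P,\ B \text{ occurs in } w\}$ is acyclic. Every nonterminal $A$ produces a unique word $\mathrm{val}(A)\in\Sigma^+$, and $\mathrm{val}(\mathbb{A})=\mathrm{val}(S)$. The size of $\mathbb{A}$ is $|\mathbb{A}|=\sum_{(A\to w)\in P}|w|$. For a nonempty word $w$, $g(w)$ denotes the size of a smallest SLP producing $w$. A grammar-based compressor $\mathcal{C}$ computes for each nonempty word $w$ an SLP $\mathcal{C}(w)$ with $\mathrm{val}(\mathcal{C}(w))=w$. With $[1,k]=\{1,\dots,k\}$, its worst-case approximation ratio is $$\alpha_{\mathcal{C}}(k,n)=\max\{|\mathcal{C}(w)|/g(w) \mid w\in[1,k]^n\}.$$ RePair: for an SLP $\mathbb{A}=(N,\Sigma,P,S)$, a word $\gamma\in(N\cup\Sigma)^+$ is a maximal string of $\mathbb{A}$ if $|\gamma|\ge 2$, $\gamma$ appears at least twice without overlap in the right-hand sides of $\mathbb{A}$, and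 no strictly longer word appears at least as many times without overlap in the right-hand sides of $\mathbb{A}$. On input $w$, RePair starts with the trivial SLP with the single rule $S\to w$. In each round it selects a most frequent maximal string $\gamma$ of the current SLP (i.e. one with the largest number of pairwise non-overlapping occurrences in the right-hand sides; ties are broken by an arbitrary fixed rule), replaces a largest set of pairwise non-overlapping occurrences of $\gamma$ in the right-hand sides by a fresh nonterminal $X$ (occurrences are replaced from left to right), and adds the rule $X\to\gamma$. It stops when the current SLP has no maximal string, and outputs the current SLP. -}

module Defs where

open import Data.Fin.Base using (Fin; zero; suc; toℕ; fromℕ<)
open import Data.Fin.Induction using (spo-noetherian)
import Data.Fin.Properties as Fin
open import Data.Integer.Base using (+_)
open import Data.List.Base
  using (List; []; _∷_; _++_; [_]; length; map; concat; concatMap; foldr; allFin;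
         cartesianProductWith)
open import Data.List.Membership.Propositional using (_∈_; mapWith∈)
open import Data.List.Membership.Propositional.Properties
  using (mapWith∈-cong; mapWith∈≗map; ∈-map⁻)
open import Data.List.NonEmpty.Base using (List⁺; _∷_; toList)
open import Data.List.Properties using (≡-dec)
open import Data.List.Relation.Binary.Prefix.Heterogeneous.Properties using (prefix?)
open import Data.List.Relation.Unary.Any as Any using (here; there)
open import Data.Nat.Base
  using (ℕ; zero; suc; _≤_; _<_; z≤n; s≤s; s≤s⁻¹; pred; NonZero; >-nonZero)
open import Data.Nat.Logarithm using (⌊log₂_⌋)
open import Data.Nat.Properties as ℕ
  using (≤-trans; ≤-reflexive; m≤m+n; m≤n+m; +-mono-≤; m≤n⇒m<n∨m≡n)
open import Data.Product.Base using (Σ; ∃; _×_; _,_; proj₁; proj₂)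
import Data.Rational.Base as ℚ
open ℚ using (ℚ; 0ℚ)
open import Data.Sum.Base as Sum using (_⊎_; inj₁; inj₂)
import Data.Sum.Properties as Sum
open import Data.Vec.Base as Vec using (Vec; []; _∷_; lookup)
open import Data.Vec.Properties using (lookup-map)
open import Function.Base using (_∘_; flip; id)
open import Induction.WellFounded using (Acc; acc; WellFounded; module Subrelation)
open import Level using (0ℓ)
open import Relation.Binary.Construct.Closure.Transitive
  using (TransClosure; module TransClosure) renaming (_++_ to _⁺++⁺_)
open TransClosure using (_∷_) renaming ([_] to edge)
open import Relation.Binary.Core using (Rel)
import Relation.Binary.Definitions as Binary
open import Relation.Binary.PropositionalEquality
  using (_≡_; _≢_; refl; sym; trans; cong; subst; isEquivalence)
open import Relation.Binary.Structures using (IsStrictPartialOrder)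
open import Relation.Nullary using (¬_; Dec; yes; no; contradiction)
open import Relation.Nullary.Decidable using (map′; _×-dec_; _⊎-dec_; ¬?)
import Relation.Unary as Unary

------------------------------------------------------------------------
-- Straight-line programs

-- Up to renaming, the nonterminals are Fin n and the alphabet is Fin k.
Symbol : ℕ → ℕ → Set
Symbol n k = Fin n ⊎ Fin k

_≟ˢ_ : ∀ {n k} → Binary.DecidableEquality (Symbol n k)
_≟ˢ_ = Sum.≡-dec Fin._≟_ Fin._≟_

-- Storing the right-hand sides in a vector indexed by the nonterminals
-- builds in that every nonterminal has exactly one production.
record Grammar (k : ℕ) : Set where
  constructor grammar
  field
    {#nt} : ℕ
    rules : Vec (List (Symbol #nt k)) #nt
    start : Fin #nt

  rhs : Fin #nt → List (Symbol #nt k)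
  rhs = lookup rules

  infix 4 _⟶_
  _⟶_ : Rel (Fin #nt) 0ℓ
  A ⟶ B = inj₁ B ∈ rhs A

  size : ℕ
  size = Vec.sum (Vec.map length rules)

open Grammar public using (size)

record IsSLP {k} (G : Grammar k) : Set where
  open Grammar G
  field
    nonempty : ∀ A → rhs A ≢ []
    acyclic  : ∀ A → ¬ TransClosure _⟶_ A A

  wellFounded : WellFounded (flip _⟶_)
  wellFounded = Subrelation.wellFounded edge (spo-noetherian isSPO)
    where
    isSPO : IsStrictPartialOrder _≡_ (TransClosure _⟶_)
    isSPO = record
      { isEquivalence = isEquivalence
      ; irrefl        = λ { {A} refl → acyclic A }
      ; trans         = _⁺++⁺_
      ; <-resp-≈      = (λ { refl → id }) , (λ { refl → id })
      }

record SLP (k : ℕ) : Set where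
  constructor slp
  field
    gram  : Grammar k
    isSLP : IsSLP gram
  open Grammar gram public hiding (size)
  open IsSLP isSLP public

∣_∣ : ∀ {k} → SLP k → ℕ
∣ 𝔸 ∣ = size (SLP.gram 𝔸)

module _ {k} (G : Grammar k) where
  open Grammar G

  mutual
    expand : ∀ A → Acc (flip _⟶_) A → List (Fin k)
    expand A (acc rs) = concat (mapWith∈ (rhs A) (expandSymbol A rs))

    expandSymbol : ∀ A → (∀ {B} → A ⟶ B → Acc (flip _⟶_) B) →
                   ∀ {s} → s ∈ rhs A → List (Fin k)
    expandSymbol A rs {inj₁ B} A⟶B = expand B (rs A⟶B)
    expandSymbol A rs {inj₂ a} _   = [ a ]

  expand-irrelevant : ∀ A (p q : Acc (flip _⟶_) A) → expand A p ≡ expand A q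
  expand-irrelevant A (acc rs) (acc rs′) =
    cong concat (mapWith∈-cong (rhs A) _ _ λ
      { {inj₁ B} A⟶B → expand-irrelevant B (rs A⟶B) (rs′ A⟶B)
      ; {inj₂ a} _   → refl })

module _ {k} (𝔸 : SLP k) where
  open SLP 𝔸

  valᴺ : Fin #nt → List (Fin k)
  valᴺ A = expand gram A (wellFounded A)

  valˢ : Symbol #nt k → List (Fin k)
  valˢ = Sum.[ valᴺ , [_] ]

  valᴺ-unfold : ∀ A → valᴺ A ≡ concatMap valˢ (rhs A)
  valᴺ-unfold A with acc rs ← wellFounded A = cong concat (trans
    (mapWith∈-cong (rhs A) _ (λ {s} _ → valˢ s) λ
      { {inj₁ B} A⟶B → expand-irrelevant gram B (rs A⟶B) (wellFounded B)
      ; {inj₂ _} _   → refl })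
    (mapWith∈≗map valˢ (rhs A)))

  val : List (Fin k)
  val = valᴺ start

trivial : ∀ {k} → List⁺ (Fin k) → Grammar k
trivial w = grammar (map inj₂ (toList w) ∷ []) zero

------------------------------------------------------------------------
-- The size g(w) of a smallest SLP producing w

Produces : ∀ {k} → List (Fin k) → ℕ → Set
Produces {k} w m = Σ (SLP k) λ 𝔸 → ∣ 𝔸 ∣ ≡ m × val 𝔸 ≡ w

IsSmallestSize : ∀ {k} → List (Fin k) → ℕ → Set
IsSmallestSize w m = Produces w m × (∀ 𝔸 → val 𝔸 ≡ w → m ≤ ∣ 𝔸 ∣)

-- The rest of this section is only needed for g to be a function: it
-- decides by exhaustive search whether w has an SLP of a given size.
private

  module Cycles {n} {E : Rel (Fin n) 0ℓ} (E? : Binary.Decidable E) where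

    -- Paths whose inner vertices are all below i (Warshall).
    Path : ℕ → Rel (Fin n) 0ℓ
    Path zero    A B = E A B
    Path (suc i) A B = Path i A B ⊎ ∃ λ v → toℕ v ≡ i × Path i A v × Path i v B

    path? : ∀ i → Binary.Decidable (Path i)
    path? zero    A B = E? A B
    path? (suc i) A B = path? i A B ⊎-dec
      Fin.any? λ v → (toℕ v ℕ.≟ i) ×-dec path? i A v ×-dec path? i v B

    sound : ∀ i {A B} → Path i A B → TransClosure E A B
    sound zero    e                    = edge e
    sound (suc i) (inj₁ p)             = sound i p
    sound (suc i) (inj₂ (_ , _ , p , q)) = sound i p ⁺++⁺ sound i q

    into : ∀ {i A v} → toℕ v ≡ i → Path (suc i) A v → Path i A v
    into v≡i (inj₁ p)                 = p
    into v≡i (inj₂ (u , u≡i , p , q))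
      with refl ← Fin.toℕ-injective (trans u≡i (sym v≡i)) = p

    outof : ∀ {i v B} → toℕ v ≡ i → Path (suc i) v B → Path i v B
    outof v≡i (inj₁ p)                 = p
    outof v≡i (inj₂ (u , u≡i , p , q))
      with refl ← Fin.toℕ-injective (trans u≡i (sym v≡i)) = q

    join : ∀ i {A v B} → toℕ v < i → Path i A v → Path i v B → Path i A B
    join (suc i) {v = v} v<1+i p q with m≤n⇒m<n∨m≡n (s≤s⁻¹ v<1+i)
    ... | inj₂ v≡i = inj₂ (v , v≡i , into v≡i p , outof v≡i q)
    ... | inj₁ v<i with p | q
    ...   | inj₁ p′ | inj₁ q′ = inj₁ (join i v<i p′ q′)
    ...   | inj₁ p′ | inj₂ (u , u≡i , q₁ , q₂) = inj₂ (u , u≡i , join i v<i p′ q₁ , q₂)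
    ...   | inj₂ (u , u≡i , p₁ , p₂) | inj₁ q′ = inj₂ (u , u≡i , p₁ , join i v<i p₂ q′)
    ...   | inj₂ (u , u≡i , p₁ , _) | inj₂ (u′ , u′≡i , _ , q₂)
      with refl ← Fin.toℕ-injective (trans u≡i (sym u′≡i)) = inj₂ (u , u≡i , p₁ , q₂)

    weaken : ∀ i {A B} → E A B → Path i A B
    weaken zero    e = e
    weaken (suc i) e = inj₁ (weaken i e)

    complete : ∀ {A B} → TransClosure E A B → Path n A B
    complete (edge e) = weaken n e
    complete (e ∷ p) = join n (Fin.toℕ<n _) (weaken n e) (complete p)

    closure? : Binary.Decidable (TransClosure E)
    closure? A B = map′ (sound n) complete (path? n A B)

  isSLP? : ∀ {k} → Unary.Decidable (IsSLP {k})
  isSLP? G = map′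
    (λ (p , q) → record { nonempty = p ; acyclic = q })
    (λ s → IsSLP.nonempty s , IsSLP.acyclic s)
    (Fin.all? (λ A → ¬? (≡-dec _≟ˢ_ (rhs A) [])) ×-dec
     Fin.all? (λ A → ¬? (closure? A A)))
    where
    open Grammar G
    open Cycles (λ A B → Any.any? (inj₁ B ≟ˢ_) (rhs A))

  Searchable : Set → Set₁
  Searchable A = ∀ {P : A → Set} → Unary.Decidable P → Dec (∃ P)

  symbol? : ∀ {n k} → Searchable (Symbol n k)
  symbol? P? = map′
    Sum.[ (λ (x , p) → inj₁ x , p) , (λ (y , p) → inj₂ y , p) ]
    (λ { (inj₁ x , p) → inj₁ (x , p) ; (inj₂ y , p) → inj₂ (y , p) })
    (Fin.any? (P? ∘ inj₁) ⊎-dec Fin.any? (P? ∘ inj₂))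

  list? : ∀ {A} → Searchable A → ∀ m {P : List A → Set} → Unary.Decidable P →
          Dec (∃ λ xs → length xs ≤ m × P xs)
  list? any? zero P? = map′
    (λ p → [] , z≤n , p) (λ { ([] , _ , p) → p ; (_ ∷ _ , () , _) }) (P? [])
  list? any? (suc m) P? = map′
    Sum.[ (λ p → [] , z≤n , p) , (λ (x , xs , le , p) → x ∷ xs , s≤s le , p) ]
    (λ { ([] , _ , p) → inj₁ p ; (x ∷ xs , s≤s le , p) → inj₂ (x , xs , le , p) })
    (P? [] ⊎-dec any? λ x → list? any? m (P? ∘ (x ∷_)))

  vec? : ∀ {A} → Searchable A → ∀ m n {P : Vec (List A) n → Set} → Unary.Decidable P →
         Dec (∃ λ xss → (∀ i → length (lookup xss i) ≤ m) × P xss)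
  vec? any? m zero P? = map′
    (λ p → [] , (λ ()) , p) (λ { ([] , _ , p) → p }) (P? [])
  vec? any? m (suc n) P? = map′
    (λ (xs , le , xss , les , p) →
      xs ∷ xss , (λ { zero → le ; (suc i) → les i }) , p)
    (λ { (xs ∷ xss , les , p) → xs , les zero , xss , les ∘ suc , p })
    (list? any? m λ xs → vec? any? m n (P? ∘ (xs ∷_)))

  lookup≤sum : ∀ {n} (xs : Vec ℕ n) i → lookup xs i ≤ Vec.sum xs
  lookup≤sum (x ∷ xs) zero    = m≤m+n x _
  lookup≤sum (x ∷ xs) (suc i) = ≤-trans (lookup≤sum xs i) (m≤n+m _ x)

  n≤sum : ∀ {n} (xs : Vec ℕ n) → (∀ i → 1 ≤ lookup xs i) → n ≤ Vec.sum xs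
  n≤sum []       _  = z≤n
  n≤sum (x ∷ xs) ge = +-mono-≤ (ge zero) (n≤sum xs (ge ∘ suc))

  length≢0 : ∀ {A : Set} {xs : List A} → xs ≢ [] → 1 ≤ length xs
  length≢0 {xs = []}    ne = contradiction refl ne
  length≢0 {xs = _ ∷ _} _  = s≤s z≤n

  rhs≤size : ∀ {k} (G : Grammar k) A → length (Grammar.rhs G A) ≤ size G
  rhs≤size (grammar rs _) A = subst (_≤ Vec.sum (Vec.map length rs)) (lookup-map A length rs)
    (lookup≤sum (Vec.map length rs) A)

  #nt≤size : ∀ {k} (𝔸 : SLP k) → SLP.#nt 𝔸 ≤ ∣ 𝔸 ∣
  #nt≤size 𝔸 = n≤sum (Vec.map length rules) λ A →
    subst (1 ≤_) (sym (lookup-map A length rules)) (length≢0 (nonempty A))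
    where open SLP 𝔸

  producedBy? : ∀ {k} w m (G : Grammar k) →
                Dec (Σ (IsSLP G) λ s → size G ≡ m × val (slp G s) ≡ w)
  producedBy? w m G with isSLP? G
  ... | no ¬s = no (¬s ∘ proj₁)
  ... | yes s = map′
    (s ,_)
    (λ (s′ , eq , v) → eq , trans
      (expand-irrelevant G S (IsSLP.wellFounded s S) (IsSLP.wellFounded s′ S)) v)
    ((size G ℕ.≟ m) ×-dec ≡-dec Fin._≟_ (val (slp G s)) w)
    where S = Grammar.start G

  produces? : ∀ {k} (w : List (Fin k)) → Unary.Decidable (Produces w)
  produces? {k} w m = map′ to from
    (Fin.any? {suc m} λ n → Fin.any? λ S → vec? symbol? m (toℕ n) λ rs →
      producedBy? w m (grammar rs S))
    where
    Search : Set
    Search = ∃ λ (n : Fin (suc m)) → ∃ λ (S : Fin (toℕ n)) →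
      ∃ λ (rs : Vec (List (Symbol (toℕ n) k)) (toℕ n)) →
      (∀ i → length (lookup rs i) ≤ m) ×
      Σ (IsSLP (grammar rs S)) λ s → size (grammar rs S) ≡ m × val (slp (grammar rs S) s) ≡ w

    to : Search → Produces w m
    to (_ , _ , _ , _ , s , eq , v) = slp _ s , eq , v

    pack : ∀ n (n′ : Fin (suc m)) → toℕ n′ ≡ n → (S : Fin n) (rs : Vec _ n) →
           (s : IsSLP {k} (grammar rs S)) → size (grammar rs S) ≡ m →
           val (slp (grammar rs S) s) ≡ w → Search
    pack _ n′ refl S rs s eq v =
      n′ , S , rs , (λ i → subst (length (lookup rs i) ≤_) eq (rhs≤size (grammar rs S) i)) , s , eq , v

    from : Produces w m → Search
    from (𝔸@(slp (grammar rs S) s) , eq , v) =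
      pack _ (fromℕ< n<1+m) (Fin.toℕ-fromℕ< n<1+m) S rs s eq v
      where n<1+m = s≤s (≤-trans (#nt≤size 𝔸) (≤-reflexive eq))

  least : ∀ {P : ℕ → Set} → Unary.Decidable P → ∀ n → P n →
          ∃ λ m → P m × (∀ j → P j → m ≤ j)
  least P? n p with P? 0
  least P? n       p | yes p₀ = 0 , p₀ , λ _ _ → z≤n
  least P? zero    p | no ¬p₀ = contradiction p ¬p₀
  least P? (suc n) p | no ¬p₀ with m , q , min ← least (P? ∘ suc) n p =
    suc m , q , λ { zero r → contradiction r ¬p₀ ; (suc j) r → s≤s (min j r) }

trivial-isSLP : ∀ {k} (w : List⁺ (Fin k)) → IsSLP (trivial w)
trivial-isSLP w = record
  { nonempty = λ { zero () }
  ; acyclic  = λ { zero (edge e) → noEdge e ; zero (_∷_ {y = zero} e _) → noEdge e }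
  }
  where
  noEdge : ∀ {B} → ¬ (inj₁ B ∈ map inj₂ (toList w))
  noEdge e with () ← proj₂ (proj₂ (∈-map⁻ inj₂ e))

trivialSLP : ∀ {k} → List⁺ (Fin k) → SLP k
trivialSLP w = slp (trivial w) (trivial-isSLP w)

val-trivial : ∀ {k} (w : List⁺ (Fin k)) → val (trivialSLP w) ≡ toList w
val-trivial w = trans (valᴺ-unfold (trivialSLP w) zero) (spell (toList w))
  where
  spell : ∀ u → concatMap (valˢ (trivialSLP w)) (map inj₂ u) ≡ u
  spell []      = refl
  spell (a ∷ u) = cong (a ∷_) (spell u)

abstract
  smallestSize : ∀ {k} (w : List⁺ (Fin k)) → ∃ (IsSmallestSize (toList w))
  smallestSize w = fromLeast (least (produces? (toList w)) ∣ trivialSLP w ∣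
                                    (trivialSLP w , refl , val-trivial w))
    where
    fromLeast : (∃ λ m → Produces (toList w) m × (∀ j → Produces (toList w) j → m ≤ j)) →
                ∃ (IsSmallestSize (toList w))
    fromLeast (m , p , min) = m , p , λ 𝔸 v → min ∣ 𝔸 ∣ (𝔸 , refl , v)

g : ∀ {k} → List⁺ (Fin k) → ℕ
g w = proj₁ (smallestSize w)

g-isSmallestSize : ∀ {k} (w : List⁺ (Fin k)) → IsSmallestSize (toList w) (g w)
g-isSmallestSize w = proj₂ (smallestSize w)

g-nonZero : ∀ {k} (w : List⁺ (Fin k)) → NonZero (g w)
g-nonZero w with (𝔸 , eq , _) , _ ← g-isSmallestSize w =
  >-nonZero (≤-trans (≤-trans (≤-trans (s≤s z≤n) (Fin.toℕ<n (SLP.start 𝔸))) (#nt≤size 𝔸))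
                     (≤-reflexive eq))

------------------------------------------------------------------------
-- Grammar-based compressors

record Compressor : Set where
  field
    compress     : ∀ {k} → List⁺ (Fin k) → SLP k
    val-compress : ∀ {k} (w : List⁺ (Fin k)) → val (compress w) ≡ toList w

open Compressor public

lists : ∀ k → ℕ → List (List (Fin k))
lists k zero    = [ [] ]
lists k (suc n) = cartesianProductWith _∷_ (allFin k) (lists k n)

-- All nonempty words of length n over an alphabet of k letters.
words : ∀ k → ℕ → List (List⁺ (Fin k))
words k zero    = []
words k (suc n) = cartesianProductWith _∷_ (allFin k) (lists k n)

ratio : Compressor → ∀ {k} → List⁺ (Fin k) → ℚ
ratio C w = + ∣ compress C w ∣ ℚ./ g w
  where instance _ = g-nonZero w

-- All ratios are positive, so starting from 0 only matters if there is
-- no word, that is, if k or n is zero.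
α : Compressor → (k n : ℕ) → ℚ
α C k n = foldr ℚ._⊔_ 0ℚ (map (ratio C) (words k n))

------------------------------------------------------------------------
-- RePair

-- A derivation of Occurs γ u m marks m pairwise non-overlapping
-- occurrences of γ in u (not necessarily as many as possible).
data Occurs {A : Set} (γ : List A) : List A → ℕ → Set where
  end  : Occurs γ [] 0
  skip : ∀ {x u m} → Occurs γ u m → Occurs γ (x ∷ u) m
  mark : ∀ {u m} → Occurs γ u m → Occurs γ (γ ++ u) (suc m)

module _ {k} (G : Grammar k) where
  open Grammar G

  Appears : List (Symbol #nt k) → ℕ → Set
  Appears γ m = ∃ λ (ms : Vec ℕ #nt) →
    (∀ A → Occurs γ (rhs A) (lookup ms A)) × Vec.sum ms ≡ m

  -- Comparison of the largest numbers of non-overlapping occurrences.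
  AtLeastAsOften : (δ γ : List (Symbol #nt k)) → Set
  AtLeastAsOften δ γ = ∀ m → Appears γ m → Appears δ m

  record MaximalString (γ : List (Symbol #nt k)) : Set where
    field
      long     : 2 ≤ length γ
      repeated : Appears γ 2
      maximal  : ∀ δ → length γ < length δ → ¬ AtLeastAsOften δ γ

  record MostFrequentMaximalString (γ : List (Symbol #nt k)) : Set where
    field
      isMaximalString : MaximalString γ
      mostFrequent    : ∀ δ → MaximalString δ → AtLeastAsOften γ δ

-- Replacing γ by a fresh nonterminal: the fresh one is zero, and the old
-- nonterminal A becomes suc A.
module _ {n k} (γ : List (Symbol n k)) where

  old : Symbol n k → Symbol (suc n) k
  old = Sum.map₁ suc

  fresh : Symbol (suc n) k
  fresh = inj₁ zero

  -- A single scan from left to right.  The counter is the number of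
  -- letters still to be dropped from the occurrence of γ just replaced.
  -- This scan replaces a largest set of non-overlapping occurrences.
  scan : ℕ → List (Symbol n k) → List (Symbol (suc n) k)
  scan _       []      = []
  scan (suc j) (x ∷ u) = scan j u
  scan zero    (x ∷ u) with prefix? _≟ˢ_ γ (x ∷ u)
  ... | yes _ = fresh ∷ scan (pred (length γ)) u
  ... | no  _ = old x ∷ scan zero u

replace : ∀ {k} (G : Grammar k) → List (Symbol (Grammar.#nt G) k) → Grammar k
replace (grammar rs S) γ =
  grammar (map (old γ) γ ∷ Vec.map (scan γ zero) rs) (suc S)

record TieBreaking : Set where
  field
    select : ∀ {k} (G : Grammar k) → List (Symbol (Grammar.#nt G) k)
    select-mostFrequent : ∀ {k} (G : Grammar k) →
      ∃ (MaximalString G) → MostFrequentMaximalString G (select G)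

open TieBreaking public

-- RePairRun τ G H : repeated rounds lead from G to the final grammar H.
data RePairRun (τ : TieBreaking) {k} : (G H : Grammar k) → Set where
  stop  : ∀ {G} → ¬ ∃ (MaximalString G) → RePairRun τ G G
  round : ∀ {G H} → ∃ (MaximalString G) →
          RePairRun τ (replace G (select τ G)) H → RePairRun τ G H

IsRePair : TieBreaking → Compressor → Set
IsRePair τ C = ∀ {k} (w : List⁺ (Fin k)) → RePairRun τ (trivial w) (SLP.gram (compress C w))

------------------------------------------------------------------------
-- Asymptotics

infix 4 _∈Ω_
_∈Ω_ : (f h : ℕ → ℚ) → Set
f ∈Ω h = ∃ λ (c : ℚ) → 0ℚ ℚ.< c × ∃ λ (N : ℕ) → ∀ n → N ≤ n → c ℚ.* h n ℚ.≤ f n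

-- log n / log log n with both logarithms to base 2 and rounded down, which
-- changes the quotient by at most a constant factor for n ≥ 4; for n < 4
-- the denominator vanishes and the value is 0 by convention.
log/loglog : ℕ → ℚ
log/loglog n with ⌊log₂ ⌊log₂ n ⌋ ⌋
... | zero      = 0ℚ
... | d@(suc _) = + ⌊log₂ n ⌋ ℚ./ d

{-# OPTIONS --safe #-}
module Submission where

-- A run 0^b of zeros is first compressed by RePair into the binary expansion
-- of b: as long as there are many copies of the newest nonterminal X_j
-- (deriving 0^(2^j)), the most frequent maximal string is X_j X_j.
-- Take the K = 2^m numbers b_i, i < K, whose expansion consists of T blocks of
-- w = 2m bits, each a leading 1 followed by the bits of i.  They form an
-- arithmetic progression, so a product of runs of these lengths has a
-- grammar of size O(K + log n).  After the binary expansion, however, no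
-- word containing two of the leading bits ("markers") occurs twice without
-- overlap, because the bits between them determine i and the nonterminals
-- themselves determine the block.  Hence every later nonterminal covers at most
-- two of the K T markers, and RePair's output has size at least K T / 2.
-- With T = K / w and K = Θ(log n) the ratio is Ω(T) = Ω(log n / log log n).
-- Three further runs, whose lengths have binary ones only at the even positions,
-- where no marker is, pad the word to an arbitrary length n.

open import Data.Bool.Base using (Bool; true; false)
open import Data.Fin.Base using (Fin; zero; suc) renaming (_<_ to _<ᶠ_)
import Data.Fin.Properties as Fin
import Data.Integer.Base as ℤ
import Data.Integer.Properties as ℤ
open import Data.List.Base
  using (List; []; _∷_; _++_; [_]; length; map; concat; concatMap; replicate; drop; foldr;
         cartesianProductWith; upTo; downFrom)
open import Data.List.Membership.Propositional using (_∈_)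
open import Data.List.Membership.Propositional.Properties
  using (∈-map⁺; ∈-map⁻; ∈-++⁺ˡ; ∈-++⁺ʳ; ∈-cartesianProductWith⁺; ∈-cartesianProductWith⁻;
         ∈-upTo⁺; ∈-upTo⁻; ∈-applyDownFrom⁺; ∈-allFin)
open import Data.List.NonEmpty.Base using (List⁺; _∷_; toList)
open import Data.List.Properties
  using (map-id; map-∘; map-cong; map-++; map-replicate; length-map; length-++; length-replicate;
         length-upTo; length-downFrom; ++-assoc; ++-identityʳ; ∷-injective;
         concatMap-++; concatMap-cong; concatMap-map; concatMap-pure)
open import Data.List.Relation.Binary.Prefix.Heterogeneous using (Prefix; []; _∷_)
open import Data.List.Relation.Binary.Prefix.Heterogeneous.Properties using (prefix?)
open import Data.List.Relation.Unary.All as All using (All; []; _∷_)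
import Data.List.Relation.Unary.All.Properties as All
open import Data.List.Relation.Unary.Any using (here; there)
open import Data.List.Relation.Unary.Unique.Propositional using (Unique; []; _∷_)
import Data.List.Relation.Unary.Unique.Propositional.Properties as Unique
open import Data.Nat.Base
open import Data.Nat.Divisibility
  using (_∣_; _∣?_; divides; ∣-trans; ∣m+n∣m⇒∣n; m∣m*n; n∣m*n; >⇒∤)
open import Data.Nat.DivMod
  using (_/_; _%_; m≡m%n+[m/n]*n; m%n<n; m≥n⇒m/n>0; m/n*n≤m)
open import Data.Nat.ListAction using (sum)
open import Data.Nat.ListAction.Properties using (sum-++)
open import Data.Nat.Logarithm
  using (⌊log₂_⌋; ⌊log₂⌋-mono-≤; ⌊log₂[2^n]⌋≡n; ⌊log₂⌊n/2⌋⌋≡⌊log₂n⌋∸1)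
open import Data.Nat.Properties
open import Data.Nat.Tactic.RingSolver using (solve-∀)
open import Data.Product.Base using (∃; ∃₂; _×_; _,_; proj₁; proj₂; uncurry)
open import Data.Product.Properties using (,-injectiveˡ; ,-injectiveʳ)
import Data.Rational.Base as ℚ
import Data.Rational.Properties as ℚ
import Data.Rational.Unnormalised.Base as ℚᵘ
import Data.Rational.Unnormalised.Properties as ℚᵘ
open import Data.Sum.Base as Sum using (_⊎_; inj₁; inj₂)
open import Data.Vec.Base as Vec using (Vec; []; _∷_; lookup)
open import Data.Vec.Properties using (lookup-map)
open import Function.Base using (_∘_; id; flip)
open import Induction.WellFounded using (Acc; acc)
open import Relation.Binary.Construct.Closure.Transitive
  using (TransClosure; _∷_) renaming ([_] to edge)
open import Relation.Binary.Definitions using (DecidableEquality)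
open import Relation.Binary.PropositionalEquality
  using (_≡_; _≢_; refl; sym; trans; cong; cong₂; subst; subst₂; module ≡-Reasoning)
open import Relation.Nullary using (¬_; yes; no; contradiction)
open import Relation.Nullary.Decidable using (_×-dec_; ¬?)

open import Defs

-- Tie-breaking is arbitrary, so late rounds cannot be followed choice by choice. During the first J
-- rounds counting forces the choice. With p pairs of the newest nonterminal present, a word with
-- any other symbol appears at most as often as there are other symbols, and a power of length at
-- least 3 would need 3p copies, where there are at most 2p plus one per run. In each round the
-- other symbols grow by at most one leftover per run and two symbols of the new rule, so they stay
-- within a `budget` polynomial in J and K. One padding run is made long enough to leave more than
-- `budget` copies of the newest nonterminal even at the end; this is what keeps the choice forced.
-- Afterwards an invariant takes over that survives every choice: a replaced string is repeated,
-- hence contains few markers.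
--
-- The block width w is even so that all markers sit at odd positions. The bits of the padding total
-- at odd positions form twice a number whose bits are at even positions, which explains three
-- padding runs: one for the even bits and two equal ones.

weight : {A : Set} → (A → ℕ) → List A → ℕ
weight φ u = sum (map φ u)

weight-++ : {A : Set} (φ : A → ℕ) (u v : List A) → weight φ (u ++ v) ≡ weight φ u + weight φ v
weight-++ φ u v = trans (cong sum (map-++ φ u v)) (sum-++ (map φ u) (map φ v))

weight≤length : {A : Set} {φ : A → ℕ} → (∀ x → φ x ≤ 1) → ∀ u → weight φ u ≤ length u
weight≤length φ≤1 []      = z≤n
weight≤length φ≤1 (x ∷ u) = +-mono-≤ (φ≤1 x) (weight≤length φ≤1 u)

weight-replicate : {A : Set} (φ : A → ℕ) (q : ℕ) (x : A) → weight φ (replicate q x) ≡ q * φ x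
weight-replicate φ zero    x = refl
weight-replicate φ (suc q) x = cong (φ x +_) (weight-replicate φ q x)

weight-zero : {A : Set} {φ : A → ℕ} {u : List A} → All (λ x → φ x ≡ 0) u → weight φ u ≡ 0
weight-zero []       = refl
weight-zero (p ∷ ps) = cong₂ _+_ p (weight-zero ps)

weight-one : {A : Set} {φ : A → ℕ} {u : List A} → All (λ x → φ x ≡ 1) u → weight φ u ≡ length u
weight-one []       = refl
weight-one (p ∷ ps) = cong₂ _+_ p (weight-one ps)

weight-factor : {A : Set} (φ : A → ℕ) (x y z : List A) → weight φ y ≤ weight φ (x ++ y ++ z)
weight-factor φ x y z = begin
  weight φ y                             ≤⟨ m≤m+n _ _ ⟩
  weight φ y + weight φ z                ≡⟨ weight-++ φ y z ⟨
  weight φ (y ++ z)                      ≤⟨ m≤n+m _ _ ⟩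
  weight φ x + weight φ (y ++ z)         ≡⟨ weight-++ φ x (y ++ z) ⟨
  weight φ (x ++ y ++ z)                 ∎
  where open ≤-Reasoning

-- Counting non-overlapping occurrences

occurs-none : {A : Set} {γ : List A} (u : List A) → Occurs γ u 0
occurs-none []      = end
occurs-none (x ∷ u) = skip (occurs-none u)

occurs-++ˡ : {A : Set} {γ : List A} (v : List A) {u : List A} {p : ℕ} →
             Occurs γ u p → Occurs γ (v ++ u) p
occurs-++ˡ []      o = o
occurs-++ˡ (x ∷ v) o = skip (occurs-++ˡ v o)

occurs-fewer : {A : Set} {γ u : List A} {p q : ℕ} → q ≤ p → Occurs γ u p → Occurs γ u q
occurs-fewer z≤n     o                 = occurs-none _
occurs-fewer (s≤s h) (skip o)          = skip (occurs-fewer (s≤s h) o)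
occurs-fewer (s≤s h) (mark o)          = mark (occurs-fewer h o)

-- Disjoint occurrences of `γ` carry disjoint copies of its weight. Every upper bound on a frequency
-- comes from this.
occurs-weight : {A : Set} {γ u : List A} {p : ℕ} (φ : A → ℕ) →
                Occurs γ u p → p * weight φ γ ≤ weight φ u
occurs-weight φ end      = z≤n
occurs-weight φ (skip o) = m≤n⇒m≤o+n _ (occurs-weight φ o)
occurs-weight {γ = γ} φ (mark {u} o) =
  ≤-trans (+-monoʳ-≤ (weight φ γ) (occurs-weight φ o)) (≤-reflexive (sym (weight-++ φ γ u)))

occurs-split : {A : Set} {γ u : List A} {p : ℕ} → Occurs γ u (suc p) →
               ∃₂ λ x y → u ≡ x ++ γ ++ y × Occurs γ y p
occurs-split (skip {x = a} o) with x , y , refl , o′ ← occurs-split o = a ∷ x , y , refl , o′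
occurs-split (mark {u} o) = [] , u , refl , o

totalWeight : {A : Set} {n : ℕ} → (A → ℕ) → Vec (List A) n → ℕ
totalWeight φ rs = Vec.sum (Vec.map (weight φ) rs)

appears-weight : {A : Set} {γ : List A} {n : ℕ} (φ : A → ℕ) (rs : Vec (List A) n) (ms : Vec ℕ n) →
                 (∀ A → Occurs γ (lookup rs A) (lookup ms A)) →
                 Vec.sum ms * weight φ γ ≤ totalWeight φ rs
appears-weight φ []       []       o = z≤n
appears-weight {γ = γ} φ (r ∷ rs) (m ∷ ms) o = begin
  (m + Vec.sum ms) * weight φ γ              ≡⟨ *-distribʳ-+ (weight φ γ) m (Vec.sum ms) ⟩
  m * weight φ γ + Vec.sum ms * weight φ γ
    ≤⟨ +-mono-≤ (occurs-weight φ (o zero)) (appears-weight φ rs ms (o ∘ suc)) ⟩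
  weight φ r + totalWeight φ rs              ∎
  where open ≤-Reasoning

sum≤n*b : {n : ℕ} (b : ℕ) (ms : Vec ℕ n) → (∀ A → lookup ms A ≤ b) → Vec.sum ms ≤ n * b
sum≤n*b b []       h = z≤n
sum≤n*b b (m ∷ ms) h = +-mono-≤ (h zero) (sum≤n*b b ms (h ∘ suc))

-- Isolates the start rule, the only long one; every other rule is charged a constant.
sum≤lookup : {n : ℕ} (b : ℕ) (ms : Vec ℕ n) (S : Fin n) → (∀ A → A ≢ S → lookup ms A ≤ b) →
             Vec.sum ms ≤ lookup ms S + n * b
sum≤lookup b (m ∷ ms) zero h =
  +-monoʳ-≤ m (m≤n⇒m≤o+n b (sum≤n*b b ms (λ A → h (suc A) λ ())))
sum≤lookup {suc n} b (m ∷ ms) (suc S) h = begin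
  m + Vec.sum ms
    ≤⟨ +-mono-≤ (h zero λ ()) (sum≤lookup b ms S λ A ne → h (suc A) (ne ∘ Fin.suc-injective)) ⟩
  b + (lookup ms S + n * b)            ≡⟨ swap b (lookup ms S) (n * b) ⟩
  lookup ms S + (b + n * b)            ∎
  where
  open ≤-Reasoning
  swap : ∀ x y z → x + (y + z) ≡ y + (x + z)
  swap = solve-∀

single : {n : ℕ} → Fin n → ℕ → Vec ℕ n
single {suc n} zero    p = p ∷ Vec.replicate n 0
single         (suc S) p = 0 ∷ single S p

sum-replicate-0 : (n : ℕ) → Vec.sum (Vec.replicate n 0) ≡ 0
sum-replicate-0 zero    = refl
sum-replicate-0 (suc n) = sum-replicate-0 n

sum-single : {n : ℕ} (S : Fin n) (p : ℕ) → Vec.sum (single S p) ≡ p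
sum-single {suc n} zero    p = trans (cong (p +_) (sum-replicate-0 n)) (+-identityʳ p)
sum-single         (suc S) p = sum-single S p

lookup-single : {n : ℕ} (S : Fin n) (p : ℕ) (P : Fin n → ℕ → Set) →
                P S p → (∀ A → P A 0) → ∀ A → P A (lookup (single S p) A)
lookup-single {suc n} zero p P pS p0 zero    = pS
lookup-single {suc n} zero p P pS p0 (suc A) = subst (P (suc A)) (sym (zeros n A)) (p0 (suc A))
  where
  zeros : ∀ n (A : Fin n) → lookup (Vec.replicate n 0) A ≡ 0
  zeros (suc n) zero    = refl
  zeros (suc n) (suc A) = zeros n A
lookup-single (suc S) p P pS p0 zero    = p0 zero
lookup-single (suc S) p P pS p0 (suc A) = lookup-single S p (P ∘ suc) pS (p0 ∘ suc) A

occurs-start⇒appears : {k : ℕ} (G : Grammar k) (let open Grammar G) {γ : List (Symbol #nt k)} {p : ℕ} →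
                       Occurs γ (rhs start) p → Appears G γ p
occurs-start⇒appears G {γ} {p} o =
  single start p ,
  lookup-single start p (λ A → Occurs γ (rhs A)) o (λ A → occurs-none (rhs A)) ,
  sum-single start p
  where open Grammar G

-- Runs of zeros under repeated halving

-- A run (q , l) stands for q copies of the most recent nonterminal
-- followed by a word spelled l: pw j labels the nonterminal that derives
-- 0^(2^j), and sep labels the letter 1.
data Label : Set where
  pw  : ℕ → Label
  sep : Label

Run : Set
Run = ℕ × List Label

odd : ℕ → Bool
odd zero          = false
odd (suc zero)    = true
odd (suc (suc n)) = odd n

bit : Bool → ℕ
bit false = 0
bit true  = 1

bit≤1 : ∀ β → bit β ≤ 1
bit≤1 false = z≤n
bit≤1 true  = ≤-refl

lowBit : ℕ → ℕ
lowBit n = bit (odd n)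

-- One round of pairing: an unpaired last copy keeps its label `pw j` and joins the front of the
-- word that ends the run.
halfRun : ℕ → Run → Run
halfRun j (q , l) = ⌊ q /2⌋ , replicate (lowBit q) (pw j) ++ l

halve : ℕ → ℕ → List Run → List Run
halve zero    j rs = rs
halve (suc i) j rs = halve i (suc j) (map (halfRun j) rs)

heads tails : List Run → ℕ
heads = weight proj₁
tails = weight (length ∘ proj₂)

halves : List Run → ℕ
halves rs = weight (⌊_/2⌋ ∘ proj₁) rs

heads-half : ∀ j rs → heads (map (halfRun j) rs) ≡ halves rs
heads-half j []       = refl
heads-half j (r ∷ rs) = cong (⌊ proj₁ r /2⌋ +_) (heads-half j rs)

halves≤heads : ∀ rs → halves rs ≤ heads rs
halves≤heads []       = z≤n
halves≤heads (r ∷ rs) = +-mono-≤ (⌊n/2⌋≤n (proj₁ r)) (halves≤heads rs)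

n≤1+2⌊n/2⌋ : ∀ n → n ≤ 1 + 2 * ⌊ n /2⌋
n≤1+2⌊n/2⌋ zero          = z≤n
n≤1+2⌊n/2⌋ (suc zero)    = ≤-refl
n≤1+2⌊n/2⌋ (suc (suc n)) = ≤-trans (s≤s (s≤s (n≤1+2⌊n/2⌋ n))) (≤-reflexive (shift ⌊ n /2⌋))
  where
  shift : ∀ x → 2 + (1 + 2 * x) ≡ 1 + 2 * (1 + x)
  shift = solve-∀

-- Pairing misses at most one copy per run.
heads≤halves : ∀ rs → heads rs ≤ length rs + 2 * halves rs
heads≤halves []             = z≤n
heads≤halves ((q , _) ∷ rs) = ≤-trans
  (+-mono-≤ (n≤1+2⌊n/2⌋ q) (heads≤halves rs))
  (≤-reflexive (shuffle ⌊ q /2⌋ (length rs) (halves rs)))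
  where
  shuffle : ∀ x y z → 1 + 2 * x + (y + 2 * z) ≡ 1 + y + 2 * (x + z)
  shuffle = solve-∀

heads-halve : ∀ i j rs → heads (halve i j rs) ≤ heads rs
heads-halve zero    j rs = ≤-refl
heads-halve (suc i) j rs = begin
  heads (halve i (suc j) (map (halfRun j) rs)) ≤⟨ heads-halve i (suc j) _ ⟩
  heads (map (halfRun j) rs)                   ≡⟨ heads-half j rs ⟩
  halves rs                                    ≤⟨ halves≤heads rs ⟩
  heads rs                                     ∎
  where open ≤-Reasoning

tails-half : ∀ j rs → tails (map (halfRun j) rs) ≤ length rs + tails rs
tails-half j []             = z≤n
tails-half j ((q , l) ∷ rs) = begin
  length (replicate (lowBit q) (pw j) ++ l) + tails (map (halfRun j) rs)
    ≡⟨ cong (_+ tails (map (halfRun j) rs)) (trans (length-++ (replicate (lowBit q) (pw j)))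
         (cong (_+ length l) (length-replicate (lowBit q)))) ⟩
  lowBit q + length l + tails (map (halfRun j) rs)
    ≤⟨ +-mono-≤ (+-monoˡ-≤ (length l) (bit≤1 (odd q))) (tails-half j rs) ⟩
  1 + length l + (length rs + tails rs)
    ≡⟨ shuffle (length l) (length rs) (tails rs) ⟩
  1 + length rs + (length l + tails rs) ∎
  where
  open ≤-Reasoning
  shuffle : ∀ x y z → 1 + x + (y + z) ≡ 1 + y + (x + z)
  shuffle = solve-∀

-- The word `x ∷ t` after a run is nonempty and free of `top`, so neighbouring runs neither merge
-- nor share a pair, also when `q` is 0.
data Text {A : Set} (label : A → Label) (top : A) : List Run → List A → Set where
  []  : Text label top [] []
  run : ∀ {x t rs u} q → All (_≢ top) (x ∷ t) → Text label top rs u →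
        Text label top ((q , map label (x ∷ t)) ∷ rs) (replicate q top ++ x ∷ t ++ u)

module Indicator {A : Set} (_≟_ : DecidableEquality A) (c : A) where

  is isnt : A → ℕ
  is x with x ≟ c
  ... | yes _ = 1
  ... | no  _ = 0
  isnt x with x ≟ c
  ... | yes _ = 0
  ... | no  _ = 1

  is≡1 : is c ≡ 1
  is≡1 with c ≟ c
  ... | yes _  = refl
  ... | no c≢c = contradiction refl c≢c

  isnt≡0 : isnt c ≡ 0
  isnt≡0 with c ≟ c
  ... | yes _  = refl
  ... | no c≢c = contradiction refl c≢c

  is≡0 : ∀ {x} → x ≢ c → is x ≡ 0
  is≡0 {x} x≢c with x ≟ c
  ... | yes x≡c = contradiction x≡c x≢c
  ... | no _    = refl

  isnt≡1 : ∀ {x} → x ≢ c → isnt x ≡ 1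
  isnt≡1 {x} x≢c with x ≟ c
  ... | yes x≡c = contradiction x≡c x≢c
  ... | no _    = refl

  isnt≤1 : ∀ x → isnt x ≤ 1
  isnt≤1 x with x ≟ c
  ... | yes _ = z≤n
  ... | no _  = ≤-refl

  power-or-mixed : ∀ δ → δ ≡ replicate (length δ) c ⊎ 1 ≤ weight isnt δ
  power-or-mixed []      = inj₁ refl
  power-or-mixed (x ∷ δ) with x ≟ c | power-or-mixed δ
  ... | no _     | _       = inj₂ (s≤s z≤n)
  ... | yes refl | inj₁ eq = inj₁ (cong (c ∷_) eq)
  ... | yes _    | inj₂ h  = inj₂ h

  module _ {label : A → Label} where

    weight-isnt : ∀ {rs u} → Text label c rs u → weight isnt u ≡ tails rs
    weight-isnt [] = refl
    weight-isnt (run {x} {t} {rs} {u} q ne txt) = begin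
      weight isnt (replicate q c ++ x ∷ t ++ u)
        ≡⟨ weight-++ isnt (replicate q c) (x ∷ t ++ u) ⟩
      weight isnt (replicate q c) + weight isnt ((x ∷ t) ++ u)
        ≡⟨ cong₂ _+_ (trans (weight-replicate isnt q c) (trans (cong (q *_) isnt≡0) (*-zeroʳ q)))
                     (weight-++ isnt (x ∷ t) u) ⟩
      weight isnt (x ∷ t) + weight isnt u
        ≡⟨ cong₂ _+_ (trans (weight-one (All.map isnt≡1 ne)) (sym (length-map label (x ∷ t))))
                     (weight-isnt txt) ⟩
      length (map label (x ∷ t)) + tails rs ∎
      where open ≡-Reasoning

    weight-is : ∀ {rs u} → Text label c rs u → weight is u ≡ heads rs
    weight-is [] = refl
    weight-is (run {x} {t} {rs} {u} q ne txt) = begin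
      weight is (replicate q c ++ x ∷ t ++ u)
        ≡⟨ weight-++ is (replicate q c) (x ∷ t ++ u) ⟩
      weight is (replicate q c) + weight is ((x ∷ t) ++ u)
        ≡⟨ cong₂ _+_ (trans (weight-replicate is q c) (trans (cong (q *_) is≡1) (*-identityʳ q)))
                     (weight-++ is (x ∷ t) u) ⟩
      q + (weight is (x ∷ t) + weight is u)
        ≡⟨ cong (q +_) (cong₂ _+_ (weight-zero (All.map is≡0 ne)) (weight-is txt)) ⟩
      q + heads rs ∎
      where open ≡-Reasoning

occurs-pairs : {A : Set} {label : A → Label} {c : A} {rs : List Run} {u : List A} →
               Text label c rs u → Occurs (c ∷ c ∷ []) u (halves rs)
occurs-pairs [] = end
occurs-pairs {c = c} (run {x} {t} {rs} {u} q _ txt) = go q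
  where
  go : ∀ q → Occurs (c ∷ c ∷ []) (replicate q c ++ x ∷ t ++ u) (⌊ q /2⌋ + halves rs)
  go zero          = occurs-++ˡ (x ∷ t) (occurs-pairs txt)
  go (suc zero)    = occurs-++ˡ (c ∷ x ∷ t) (occurs-pairs txt)
  go (suc (suc q)) = mark (go q)

module _ {n k : ℕ} {c : Symbol n k} where

  scan-clean : ∀ {t} u → All (_≢ c) t →
               scan (c ∷ c ∷ []) 0 (t ++ u) ≡ map (old (c ∷ c ∷ [])) t ++ scan (c ∷ c ∷ []) 0 u
  scan-clean u [] = refl
  scan-clean {x ∷ t} u (x≢c ∷ ne) with prefix? _≟ˢ_ (c ∷ c ∷ []) (x ∷ t ++ u)
  ... | yes (c≡x ∷ _) = contradiction (sym c≡x) x≢c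
  ... | no _          = cong (_ ∷_) (scan-clean u ne)

  -- The scan pairs from the left, so an odd copy remains at the right end of the run, before the
  -- leftovers of earlier rounds. Thus the binary expansion appears with its most significant bit
  -- first.
  scan-run : ∀ {x} q u → x ≢ c →
             scan (c ∷ c ∷ []) 0 (replicate q c ++ x ∷ u) ≡
             replicate ⌊ q /2⌋ (fresh (c ∷ c ∷ [])) ++
             replicate (lowBit q) (old (c ∷ c ∷ []) c) ++ scan (c ∷ c ∷ []) 0 (x ∷ u)
  scan-run zero u x≢c = refl
  scan-run {x} (suc zero) u x≢c with prefix? _≟ˢ_ (c ∷ c ∷ []) (c ∷ x ∷ u)
  ... | yes (_ ∷ c≡x ∷ _) = contradiction (sym c≡x) x≢c
  ... | no _              = refl
  scan-run {x} (suc (suc q)) u x≢c with prefix? _≟ˢ_ (c ∷ c ∷ []) (c ∷ c ∷ replicate q c ++ x ∷ u)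
  ... | yes _ = cong (_ ∷_) (scan-run q u x≢c)
  ... | no ¬p = contradiction (refl ∷ refl ∷ []) ¬p

relabel : {n k : ℕ} → ℕ → (Symbol n k → Label) → Symbol (suc n) k → Label
relabel j label (inj₁ zero)    = pw j
relabel j label (inj₁ (suc A)) = label (inj₁ A)
relabel j label (inj₂ a)       = label (inj₂ a)

relabel-old : {n k : ℕ} (j : ℕ) (label : Symbol n k → Label) (γ : List (Symbol n k)) →
              ∀ x → relabel j label (old γ x) ≡ label x
relabel-old j label γ (inj₁ A) = refl
relabel-old j label γ (inj₂ a) = refl

map-relabel-old : {n k : ℕ} (j : ℕ) (label : Symbol n k → Label) (γ : List (Symbol n k)) →
                  ∀ t → map (relabel j label) (map (old γ) t) ≡ map label t
map-relabel-old j label γ []      = refl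
map-relabel-old j label γ (x ∷ t) = cong₂ _∷_ (relabel-old j label γ x) (map-relabel-old j label γ t)

old≢fresh : {n k : ℕ} (γ : List (Symbol n k)) → ∀ x → old γ x ≢ fresh γ
old≢fresh γ (inj₁ _) ()
old≢fresh γ (inj₂ _) ()

map-old-fresh : {n k : ℕ} (γ t : List (Symbol n k)) → All (_≢ fresh γ) (map (old γ) t)
map-old-fresh γ t = All.map⁺ (All.universal (old≢fresh γ) t)

module _ {n k : ℕ} {c : Symbol n k} {label : Symbol n k → Label} {j : ℕ} (eq : label c ≡ pw j) where

  private
    cc : List (Symbol n k)
    cc = c ∷ c ∷ []

  text-scan : ∀ {rs u} → Text label c rs u →
              Text (relabel (suc j) label) (fresh cc) (map (halfRun j) rs) (scan cc 0 u)
  text-scan [] = []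
  text-scan (run {x} {t} {rs} {u} q ne@(x≢c ∷ _) txt) =
    subst (Text _ _ _) (sym scanned) (halved (lowBit q) (bit≤1 (odd q)))
    where
    rest = scan cc 0 u
    scanned : scan cc 0 (replicate q c ++ x ∷ t ++ u) ≡
              replicate ⌊ q /2⌋ (fresh cc) ++ replicate (lowBit q) (old cc c) ++ map (old cc) (x ∷ t) ++ rest
    scanned = trans (scan-run q (t ++ u) x≢c)
      (cong (λ v → replicate ⌊ q /2⌋ (fresh cc) ++ replicate (lowBit q) (old cc c) ++ v) (scan-clean u ne))
    halved : ∀ r → r ≤ 1 → Text (relabel (suc j) label) (fresh cc)
      ((⌊ q /2⌋ , replicate r (pw j) ++ map label (x ∷ t)) ∷ map (halfRun j) rs)
      (replicate ⌊ q /2⌋ (fresh cc) ++ replicate r (old cc c) ++ map (old cc) (x ∷ t) ++ rest)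
    halved zero _ =
      subst (λ l → Text (relabel (suc j) label) (fresh cc) ((⌊ q /2⌋ , l) ∷ map (halfRun j) rs)
              (replicate ⌊ q /2⌋ (fresh cc) ++ map (old cc) (x ∷ t) ++ rest))
            (map-relabel-old (suc j) label cc (x ∷ t))
            (run ⌊ q /2⌋ (map-old-fresh cc (x ∷ t)) (text-scan txt))
    halved (suc zero) _ =
      subst (λ l → Text (relabel (suc j) label) (fresh cc) ((⌊ q /2⌋ , l) ∷ map (halfRun j) rs)
              (replicate ⌊ q /2⌋ (fresh cc) ++ map (old cc) (c ∷ x ∷ t) ++ rest))
            (trans (map-relabel-old (suc j) label cc (c ∷ x ∷ t)) (cong (_∷ map label (x ∷ t)) eq))
            (run ⌊ q /2⌋ (map-old-fresh cc (c ∷ x ∷ t)) (text-scan txt))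
    halved (suc (suc _)) (s≤s ())

-- The first phase: pairing is forced

-- `short` bounds the symbols other than `top` outside the start rule by two per nonterminal.
-- `below` confines `top` to the start rule, so that the runs account for all of its copies.
record Stage {k : ℕ} (j : ℕ) (rs : List Run) (G : Grammar k) : Set where
  open Grammar G
  field
    label     : Symbol #nt k → Label
    top       : Symbol #nt k
    label-top : label top ≡ pw j
    text      : Text label top rs (rhs start)
    short     : ∀ A → A ≢ start → length (rhs A) ≤ 2
    below     : ∀ A → A ≢ start → All (_≢ top) (rhs A)

module _ {k j : ℕ} {rs : List Run} {G : Grammar k} (st : Stage j rs G)
         (many : 2 * Grammar.#nt G + tails rs < halves rs) (few : length rs < halves rs) where
  open Grammar G
  open Stage st
  open Indicator _≟ˢ_ top

  private
    cc : List (Symbol #nt k)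
    cc = top ∷ top ∷ []

    p : ℕ
    p = halves rs

    total-isnt : totalWeight isnt rules ≤ tails rs + #nt * 2
    total-isnt = begin
      totalWeight isnt rules
        ≤⟨ sum≤lookup 2 (Vec.map (weight isnt) rules) start (λ A A≢S →
             subst (_≤ 2) (sym (lookup-map A (weight isnt) rules))
               (≤-trans (weight≤length isnt≤1 (rhs A)) (short A A≢S))) ⟩
      lookup (Vec.map (weight isnt) rules) start + #nt * 2
        ≡⟨ cong (_+ #nt * 2) (trans (lookup-map start (weight isnt) rules) (weight-isnt text)) ⟩
      tails rs + #nt * 2 ∎
      where open ≤-Reasoning hiding (start)

    total-is : totalWeight is rules ≤ heads rs
    total-is = begin
      totalWeight is rules
        ≤⟨ sum≤lookup 0 (Vec.map (weight is) rules) start (λ A A≢S →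
             ≤-reflexive (trans (lookup-map A (weight is) rules)
               (weight-zero (All.map is≡0 (below A A≢S))))) ⟩
      lookup (Vec.map (weight is) rules) start + #nt * 0
        ≡⟨ cong₂ _+_ (trans (lookup-map start (weight is) rules) (weight-is text)) (*-zeroʳ #nt) ⟩
      heads rs + 0 ≡⟨ +-identityʳ _ ⟩
      heads rs ∎
      where open ≤-Reasoning hiding (start)

    bounded : (φ : Symbol #nt k → ℕ) {δ : List (Symbol #nt k)} → Appears G δ p →
              p * weight φ δ ≤ totalWeight φ rules
    bounded φ {δ} (ms , occ , eq) = subst (λ m → m * weight φ δ ≤ totalWeight φ rules) eq
      (appears-weight φ rules ms occ)

  pair-appears : Appears G cc p
  pair-appears = occurs-start⇒appears G (occurs-pairs text)

  -- A mixed word is outnumbered by the symbols other than top, and the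
  -- powers of top of length at least 3 compete for the same letters.
  appears⇒pair : ∀ δ → 2 ≤ length δ → Appears G δ p → δ ≡ cc
  appears⇒pair δ 2≤δ app with power-or-mixed δ
  ... | inj₂ mixed = contradiction many (≤⇒≯ (begin
      p                       ≡⟨ *-identityʳ p ⟨
      p * 1                   ≤⟨ *-monoʳ-≤ p mixed ⟩
      p * weight isnt δ       ≤⟨ bounded isnt app ⟩
      totalWeight isnt rules  ≤⟨ total-isnt ⟩
      tails rs + #nt * 2      ≡⟨ flipped (tails rs) #nt ⟩
      2 * #nt + tails rs      ∎))
    where
    open ≤-Reasoning hiding (start)
    flipped : ∀ x y → x + y * 2 ≡ 2 * y + x
    flipped = solve-∀
  ... | inj₁ power with m≤n⇒m<n∨m≡n 2≤δ
  ...   | inj₂ 2≡δ = trans power (cong (λ m → replicate m top) (sym 2≡δ))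
  ...   | inj₁ 3≤δ = contradiction few (≤⇒≯ (+-cancelʳ-≤ (2 * p) p (length rs) (begin
      p + 2 * p               ≡⟨ *-comm 3 p ⟩
      p * 3                   ≤⟨ *-monoʳ-≤ p 3≤δ ⟩
      p * length δ            ≡⟨ cong (p *_) weight-power ⟨
      p * weight is δ         ≤⟨ bounded is app ⟩
      totalWeight is rules    ≤⟨ total-is ⟩
      heads rs                ≤⟨ heads≤halves rs ⟩
      length rs + 2 * p       ∎)))
    where
    open ≤-Reasoning hiding (start)
    weight-power : weight is δ ≡ length δ
    weight-power = trans (cong (weight is) power) (trans (weight-replicate is (length δ) top)
      (trans (cong (length δ *_) is≡1) (*-identityʳ (length δ))))

  -- A longer word appearing as often would have to be the pair itself.
  pair-maximal : MaximalString G cc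
  pair-maximal = record
    { long     = ≤-refl
    ; repeated = occurs-start⇒appears G (occurs-fewer 2≤p (occurs-pairs text))
    ; maximal  = λ δ cc<δ often → contradiction
        (cong length (appears⇒pair δ (<⇒≤ cc<δ) (often p pair-appears))) (>⇒≢ cc<δ)
    }
    where
    nt≥1 : Fin #nt → 1 ≤ #nt
    nt≥1 zero    = s≤s z≤n
    nt≥1 (suc _) = s≤s z≤n
    2≤p : 2 ≤ p
    2≤p = ≤-trans (*-monoʳ-≤ 2 (nt≥1 start)) (≤-trans (m≤m+n (2 * #nt) (tails rs)) (<⇒≤ many))

  -- No tie can arise: a most frequent maximal string appears at least as often as the pair, and no
  -- other word of length at least 2 does.
  selects-pair : (τ : TieBreaking) → select τ G ≡ cc
  selects-pair τ = appears⇒pair (select τ G) (MaximalString.long (isMaximalString best))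
                     (mostFrequent best cc pair-maximal p pair-appears)
    where
    open MostFrequentMaximalString
    best : MostFrequentMaximalString G (select τ G)
    best = select-mostFrequent τ G (cc , pair-maximal)

  -- The other rules lack `top`, so the scan merely renames their symbols.
  stage-step : Stage (suc j) (map (halfRun j) rs) (replace G cc)
  stage-step = record
    { label     = relabel (suc j) label
    ; top       = fresh cc
    ; label-top = refl
    ; text      = subst (Text _ _ _) (sym (lookup-map start (scan cc 0) rules)) (text-scan label-top text)
    ; short     = λ { zero _ → ≤-refl
                    ; (suc A) A≢S → subst ((_≤ 2) ∘ length) (sym (scanned A (A≢S ∘ cong suc)))
                        (subst (_≤ 2) (sym (length-map (old cc) (rhs A))) (short A (A≢S ∘ cong suc))) }
    ; below     = λ { zero _ → map-old-fresh cc cc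
                    ; (suc A) A≢S → subst (All (_≢ fresh cc)) (sym (scanned A (A≢S ∘ cong suc)))
                        (map-old-fresh cc (rhs A)) }
    }
    where
    scanned : ∀ A → A ≢ start → lookup (Vec.map (scan cc 0) rules) A ≡ map (old cc) (rhs A)
    scanned A A≢S = begin
      lookup (Vec.map (scan cc 0) rules) A  ≡⟨ lookup-map A (scan cc 0) rules ⟩
      scan cc 0 (rhs A)                     ≡⟨ cong (scan cc 0) (++-identityʳ (rhs A)) ⟨
      scan cc 0 (rhs A ++ [])               ≡⟨ scan-clean [] (below A A≢S) ⟩
      map (old cc) (rhs A) ++ []            ≡⟨ ++-identityʳ _ ⟩
      map (old cc) (rhs A)                  ∎
      where
      open ≡-Reasoning

-- `B` bounds the symbols other than `top` through all `i` remaining rounds: each round adds two for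
-- the new rule and at most one leftover per run, hence the summand `2 + length rs` per round.
phase₁ : ∀ {k} (τ : TieBreaking) (B : ℕ) i j rs {G H : Grammar k} → Stage j rs G → RePairRun τ G H →
         length rs ≤ B → i * (2 + length rs) + (2 * Grammar.#nt G + tails rs) ≤ B →
         B < heads (halve i j rs) →
         ∃ λ G′ → Stage (i + j) (halve i j rs) G′ × RePairRun τ G′ H
phase₁ τ B zero    j rs st r _ _ _ = _ , st , r
phase₁ τ B (suc i) j rs {G} {H} st r runs≤B budget enough = go r
  where
  open Grammar G using (#nt)
  -- Halving never increases `heads`, so the copies that survive all rounds already outnumber `B` in
  -- the present one.
  B<halves : B < halves rs
  B<halves = ≤-trans enough
    (≤-trans (heads-halve i (suc j) (map (halfRun j) rs)) (≤-reflexive (heads-half j rs)))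
  many : 2 * #nt + tails rs < halves rs
  many = ≤-trans (s≤s (≤-trans (m≤n+m (2 * #nt + tails rs) (suc i * (2 + length rs))) budget)) B<halves
  few : length rs < halves rs
  few = ≤-trans (s≤s runs≤B) B<halves
  same : length (map (halfRun j) rs) ≡ length rs
  same = length-map (halfRun j) rs
  budget′ : i * (2 + length (map (halfRun j) rs)) + (2 * suc #nt + tails (map (halfRun j) rs)) ≤ B
  budget′ = begin
    i * (2 + length (map (halfRun j) rs)) + (2 * suc #nt + tails (map (halfRun j) rs))
      ≤⟨ +-mono-≤ (≤-reflexive (cong (λ m → i * (2 + m)) same)) (+-monoʳ-≤ (2 * suc #nt) (tails-half j rs)) ⟩
    i * (2 + length rs) + (2 * suc #nt + (length rs + tails rs))
      ≡⟨ shuffle (i * (2 + length rs)) #nt (length rs) (tails rs) ⟩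
    suc i * (2 + length rs) + (2 * #nt + tails rs)  ≤⟨ budget ⟩
    B ∎
    where
    open ≤-Reasoning hiding (start)
    shuffle : ∀ a n l t → a + (2 * (1 + n) + (l + t)) ≡ 2 + l + a + (2 * n + t)
    shuffle = solve-∀
  go : RePairRun τ G H → ∃ λ G′ → Stage (suc i + j) (halve (suc i) j rs) G′ × RePairRun τ G′ H
  go (stop none) = contradiction (_ , pair-maximal st many few) none
  go (round _ r) = subst (λ m → ∃ λ G′ → Stage m (halve (suc i) j rs) G′ × RePairRun τ G′ H) (+-suc i j)
    (phase₁ τ B i (suc j) (map (halfRun j) rs)
      (stage-step st many few)
      (subst (λ γ → RePairRun τ (replace G γ) H) (selects-pair st many few τ) r)
      (subst (_≤ B) (sym same) runs≤B) budget′ enough)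

-- The second phase: repeated words are light

unfold : {Γ : Set} {n k : ℕ} → List (Symbol n k) → (Symbol n k → List Γ) → Symbol (suc n) k → List Γ
unfold γ e (inj₁ zero)    = concatMap e γ
unfold γ e (inj₁ (suc A)) = e (inj₁ A)
unfold γ e (inj₂ a)       = e (inj₂ a)

module _ {Γ : Set} {n k : ℕ} (γ : List (Symbol n k)) (e : Symbol n k → List Γ) where

  unfold-old : ∀ x → unfold γ e (old γ x) ≡ e x
  unfold-old (inj₁ A) = refl
  unfold-old (inj₂ a) = refl

  concatMap-unfold-old : ∀ u → concatMap (unfold γ e) (map (old γ) u) ≡ concatMap e u
  concatMap-unfold-old u = trans (concatMap-map (unfold γ e) (old γ) u) (concatMap-cong unfold-old u)

  -- `drop j` accounts for the letters of the last replaced occurrence that the scan still has to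
  -- pass; its first letter is consumed with the match, hence `pred`.
  concatMap-scan : 1 ≤ length γ → ∀ j u →
                   concatMap (unfold γ e) (scan γ j u) ≡ concatMap e (drop j u)
  concatMap-scan γ≥1 zero    []      = refl
  concatMap-scan γ≥1 (suc j) []      = refl
  concatMap-scan γ≥1 (suc j) (x ∷ u) = concatMap-scan γ≥1 j u
  concatMap-scan γ≥1 zero (x ∷ u) with prefix? _≟ˢ_ γ (x ∷ u)
  ... | yes pre = trans (cong (concatMap e γ ++_) (concatMap-scan γ≥1 (pred (length γ)) u))
                        (rejoin γ γ≥1 pre)
    where
    rejoin′ : ∀ δ {v} → Prefix _≡_ δ v → concatMap e δ ++ concatMap e (drop (length δ) v) ≡ concatMap e v
    rejoin′ []      []          = refl
    rejoin′ (y ∷ δ) (refl ∷ ps) = trans (++-assoc (e y) _ _) (cong (e y ++_) (rejoin′ δ ps))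
    rejoin : ∀ δ → 1 ≤ length δ → Prefix _≡_ δ (x ∷ u) →
             concatMap e δ ++ concatMap e (drop (pred (length δ)) u) ≡ e x ++ concatMap e u
    rejoin (y ∷ δ) _ (refl ∷ ps) = trans (++-assoc (e y) _ _) (cong (e y ++_) (rejoin′ δ ps))
  ... | no _ = cong₂ _++_ (unfold-old x) (concatMap-scan γ≥1 0 u)

RepeatsBelow : {Γ : Set} → (Γ → ℕ) → ℕ → List Γ → Set
RepeatsBelow μ b u = ∀ x y z z′ → u ≡ x ++ y ++ z ++ y ++ z′ → weight μ y ≤ b

-- `u` is the start rule as it stands after the first phase. Nonterminals of that phase mean single
-- letters of `u` although their rules have two symbols, so `meaning` is kept apart from the rules
-- and lightness is recorded for both.
record Refines {Γ : Set} (μ : Γ → ℕ) (b : ℕ) (u : List Γ) {k : ℕ} (G : Grammar k) : Set where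
  open Grammar G
  field
    meaning       : Symbol #nt k → List Γ
    light-symbols : ∀ s → weight μ (meaning s) ≤ b
    light-rules   : ∀ A → A ≢ start → weight μ (concatMap meaning (rhs A)) ≤ b
    text          : concatMap meaning (rhs start) ≡ u

appears-twice : {k : ℕ} (G : Grammar k) (let open Grammar G) {γ : List (Symbol #nt k)} → Appears G γ 2 →
                Occurs γ (rhs start) 2 ⊎ ∃ λ A → A ≢ start × Occurs γ (rhs A) 1
appears-twice G (ms , occ , eq)
  with Fin.any? (λ A → ¬? (A Fin.≟ start) ×-dec (1 ≤? lookup ms A))
  where open Grammar G
... | yes (A , A≢S , once) = inj₂ (A , A≢S , occurs-fewer once (occ A))
... | no none = inj₁ (occurs-fewer twice (occ start))
  where
  open Grammar G
  absent : ∀ A → A ≢ start → lookup ms A ≤ 0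
  absent A A≢S = ≮⇒≥ (λ once → none (A , A≢S , once))
  twice : 2 ≤ lookup ms start
  twice = begin
    2                              ≡⟨ eq ⟨
    Vec.sum ms                     ≤⟨ sum≤lookup 0 ms start absent ⟩
    lookup ms start + #nt * 0      ≡⟨ cong (lookup ms start +_) (*-zeroʳ #nt) ⟩
    lookup ms start + 0            ≡⟨ +-identityʳ _ ⟩
    lookup ms start                ∎
    where open ≤-Reasoning hiding (start)

module _ {Γ : Set} {μ : Γ → ℕ} {b : ℕ} {u : List Γ} (rep : RepeatsBelow μ b u) where

  -- An occurrence outside the start rule inherits the bound of its rule; two occurrences in the
  -- start rule become two disjoint occurrences in `u`.
  refines-light : ∀ {k} {G : Grammar k} (ref : Refines μ b u G) (let open Refines ref) →
                  ∀ {γ} → Appears G γ 2 → weight μ (concatMap meaning γ) ≤ b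
  refines-light {G = G} ref {γ} app with appears-twice G app
  ... | inj₂ (A , A≢S , once) with x , y , eq , _ ← occurs-split once = begin
      weight μ (concatMap meaning γ)
        ≤⟨ weight-factor μ (concatMap meaning x) (concatMap meaning γ) (concatMap meaning y) ⟩
      weight μ (concatMap meaning x ++ concatMap meaning γ ++ concatMap meaning y)
        ≡⟨ cong (weight μ) (trans (concatMap-++ meaning x (γ ++ y))
             (cong (concatMap meaning x ++_) (concatMap-++ meaning γ y))) ⟨
      weight μ (concatMap meaning (x ++ γ ++ y))
        ≡⟨ cong (weight μ ∘ concatMap meaning) eq ⟨
      weight μ (concatMap meaning (rhs A))
        ≤⟨ light-rules A A≢S ⟩
      b ∎
    where
    open Refines ref
    open Grammar G
    open ≤-Reasoning hiding (start)
  ... | inj₁ twice with x , v , eq , once ← occurs-split twice with z , z′ , refl , _ ← occurs-split once =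
    rep (concatMap meaning x) (concatMap meaning γ) (concatMap meaning z) (concatMap meaning z′) (begin
      u                                         ≡⟨ text ⟨
      concatMap meaning (rhs start)             ≡⟨ cong (concatMap meaning) eq ⟩
      concatMap meaning (x ++ γ ++ z ++ γ ++ z′)
        ≡⟨ concatMap-++ meaning x _ ⟩
      _ ≡⟨ cong (concatMap meaning x ++_) (concatMap-++ meaning γ _) ⟩
      _ ≡⟨ cong (λ v → concatMap meaning x ++ concatMap meaning γ ++ v) (concatMap-++ meaning z _) ⟩
      _ ≡⟨ cong (λ v → concatMap meaning x ++ concatMap meaning γ ++ concatMap meaning z ++ v)
             (concatMap-++ meaning γ z′) ⟩
      concatMap meaning x ++ concatMap meaning γ ++ concatMap meaning z ++
        concatMap meaning γ ++ concatMap meaning z′ ∎)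
    where
    open Refines ref
    open Grammar G
    open ≡-Reasoning

  refines-replace : ∀ {k} {G : Grammar k} → Refines μ b u G → ∀ {γ} → MaximalString G γ →
                    Refines μ b u (replace G γ)
  refines-replace {G = G} ref {γ} max = record
    { meaning       = unfold γ meaning
    ; light-symbols = λ { (inj₁ zero)    → light-γ
                        ; (inj₁ (suc A)) → light-symbols (inj₁ A)
                        ; (inj₂ a)       → light-symbols (inj₂ a) }
    ; light-rules   = λ { zero _ → subst (λ v → weight μ v ≤ b)
                            (sym (concatMap-unfold-old γ meaning γ)) light-γ
                        ; (suc A) A≢S → subst (λ v → weight μ v ≤ b)
                            (sym (same A)) (light-rules A (A≢S ∘ cong suc)) }
    ; text          = trans (same start) text
    }
    where
    open Refines ref
    open Grammar G
    open MaximalString max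
    light-γ : weight μ (concatMap meaning γ) ≤ b
    light-γ = refines-light ref repeated
    same : ∀ A → concatMap (unfold γ meaning) (lookup (Vec.map (scan γ 0) rules) A) ≡
                 concatMap meaning (rhs A)
    same A = trans (cong (concatMap (unfold γ meaning)) (lookup-map A (scan γ 0) rules))
                   (concatMap-scan γ meaning (<⇒≤ long) 0 (rhs A))

  -- A maximal string is repeated and therefore light, whichever one is selected.
  phase₂ : ∀ {k} (τ : TieBreaking) {G H : Grammar k} → RePairRun τ G H → Refines μ b u G → Refines μ b u H
  phase₂ τ (stop _)      ref = ref
  phase₂ τ (round max r) ref = phase₂ τ r
    (refines-replace ref (MostFrequentMaximalString.isMaximalString (select-mostFrequent τ _ max)))

weight-concatMap : {A Γ : Set} (μ : Γ → ℕ) (e : A → List Γ) {b : ℕ} → (∀ s → weight μ (e s) ≤ b) →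
                   ∀ u → weight μ (concatMap e u) ≤ length u * b
weight-concatMap μ e light []      = z≤n
weight-concatMap μ e light (s ∷ u) = ≤-trans (≤-reflexive (weight-++ μ (e s) (concatMap e u)))
  (+-mono-≤ (light s) (weight-concatMap μ e light u))

lookup≤sum : ∀ {n} (xs : Vec ℕ n) i → lookup xs i ≤ Vec.sum xs
lookup≤sum (x ∷ xs) zero    = m≤m+n x _
lookup≤sum (x ∷ xs) (suc i) = m≤n⇒m≤o+n x (lookup≤sum xs i)

rhs≤size : ∀ {k} (G : Grammar k) A → length (Grammar.rhs G A) ≤ size G
rhs≤size G A = subst (_≤ size G) (lookup-map A length rules) (lookup≤sum (Vec.map length rules) A)
  where open Grammar G hiding (size)

-- The start rule alone has to spell `u`, with symbols worth at most `b` each.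
refines-size : ∀ {Γ : Set} {μ : Γ → ℕ} {b : ℕ} {u : List Γ} {k} {G : Grammar k} → Refines μ b u G →
               weight μ u ≤ size G * b
refines-size {μ = μ} {b} {u} {G = G} ref = begin
  weight μ u                                ≡⟨ cong (weight μ) text ⟨
  weight μ (concatMap meaning (rhs start))  ≤⟨ weight-concatMap μ meaning light-symbols (rhs start) ⟩
  length (rhs start) * b                    ≤⟨ *-monoˡ-≤ b (rhs≤size G start) ⟩
  size G * b                                ∎
  where
  open Refines ref
  open Grammar G hiding (size)
  open ≤-Reasoning hiding (start)

-- Marked words with pairwise distinct items

unique-product : {A B C : Set} (f : A → B → C) {xs : List A} {ys : List B} →
  (∀ {x x′ y y′} → x ∈ xs → x′ ∈ xs → f x y ≡ f x′ y′ → x ≡ x′ × y ≡ y′) →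
  Unique xs → Unique ys → Unique (cartesianProductWith f xs ys)
unique-product f inj [] uys = []
unique-product f {x ∷ xs} {ys} inj (x∉xs ∷ uxs) uys = Unique.++⁺
  (Unique.map⁺ (λ eq → proj₂ (inj (here refl) (here refl) eq)) uys)
  (unique-product f (λ p q → inj (there p) (there q)) uxs uys)
  disjoint
  where
  disjoint : ∀ {z} → ¬ (z ∈ map (f x) ys × z ∈ cartesianProductWith f xs ys)
  disjoint (p , q) with _ , _ , refl ← ∈-map⁻ (f x) p
    with x′ , _ , x′∈xs , _ , eq ← ∈-cartesianProductWith⁻ f xs ys q =
    All.lookup x∉xs x′∈xs (proj₁ (inj (here refl) (there x′∈xs) eq))

unique-once : {A : Set} (xs ys : List A) {zs : List A} {x : A} → ¬ Unique (xs ++ x ∷ ys ++ x ∷ zs)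
unique-once []       ys (x∉ ∷ _) = All.head (All.++⁻ʳ ys x∉) refl
unique-once (_ ∷ xs) ys (_ ∷ u)  = unique-once xs ys u

-- A marked word is cut into items, a marker and the unmarked letters after it.
module Marked {A : Set} (μ : A → ℕ) (μ≤1 : ∀ a → μ a ≤ 1) where

  Item : Set
  Item = A × List A

  flat : List Item → List A
  flat = concatMap (uncurry _∷_)

  Unmarked : List A → Set
  Unmarked = All (λ a → μ a ≡ 0)

  Wellformed : Item → Set
  Wellformed (a , b) = μ a ≢ 0 × Unmarked b

  -- Letters weigh at most 1, so a word of weight at least 2 still has a marker after its first one.
  first-marker : ∀ y → 1 ≤ weight μ y →
                 ∃₂ λ x a → ∃ λ z → y ≡ x ++ a ∷ z × Unmarked x × μ a ≢ 0 × weight μ y ≤ 1 + weight μ z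
  first-marker (a ∷ y) h with μ a in eq
  ... | suc k = [] , a , y , refl , [] , (λ eq′ → contradiction (trans (sym eq′) eq) λ ()) ,
    +-monoˡ-≤ (weight μ y) (subst (_≤ 1) eq (μ≤1 a))
  ... | zero with x , a′ , z , refl , ux , ma , le ← first-marker y h =
    a ∷ x , a′ , z , refl , eq ∷ ux , ma , le

  body-unique : ∀ b y {is a z} → Unmarked b → All Wellformed is → Unmarked y → μ a ≢ 0 →
                b ++ flat is ≡ y ++ a ∷ z → b ≡ y × flat is ≡ a ∷ z
  body-unique []      []      _ _ _ _ eq = refl , eq
  body-unique []      (c ∷ y) {(a′ , _) ∷ _} _ ((ma′ , _) ∷ _) (uc ∷ _) _ eq
    with refl , _ ← ∷-injective eq = contradiction uc ma′
  body-unique (c ∷ b) []      (uc ∷ _) _ _ ma eq with refl , _ ← ∷-injective eq = contradiction uc ma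
  body-unique (c ∷ b) (d ∷ y) (_ ∷ ub) wf (_ ∷ uy) ma eq
    with refl , eq′ ← ∷-injective eq with refl , eq″ ← body-unique b y ub wf uy ma eq′ = refl , eq″

  -- Only unmarked letters lie between the markers `a` and `c`, so `b` is the whole body of an item.
  -- The closing marker `c` excludes that `b` is only a prefix of that body.
  locate : ∀ x junk is {a b c z} → Unmarked junk → All Wellformed is → μ a ≢ 0 → Unmarked b → μ c ≢ 0 →
           junk ++ flat is ≡ x ++ a ∷ b ++ c ∷ z →
           ∃₂ λ is₁ is₂ → is ≡ is₁ ++ (a , b) ∷ is₂ × flat is₂ ≡ c ∷ z
  locate [] [] [] _ _ _ _ _ ()
  locate (_ ∷ _) [] [] _ _ _ _ _ ()
  locate [] (d ∷ junk) is (ud ∷ _) wf ma ub mc eq with refl , _ ← ∷-injective eq = contradiction ud ma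
  locate (_ ∷ x) (_ ∷ junk) is (_ ∷ uj) wf ma ub mc eq =
    locate x junk is uj wf ma ub mc (proj₂ (∷-injective eq))
  locate [] [] ((_ , b′) ∷ is) {b = b} _ ((_ , ub′) ∷ wf) ma ub mc eq
    with refl , eq′ ← ∷-injective eq with refl , eq″ ← body-unique b′ b ub′ wf ub mc eq′ =
    [] , is , refl , eq″
  locate (_ ∷ x) [] ((a′ , b′) ∷ is) _ ((_ , ub′) ∷ wf) ma ub mc eq
    with is₁ , is₂ , refl , eq′ ← locate x b′ is ub′ wf ma ub mc (proj₂ (∷-injective eq)) =
    (a′ , b′) ∷ is₁ , is₂ , refl , eq′

  private
    twice : ∀ (x y₁ : List A) a b c y₃ z z′ (let y = y₁ ++ a ∷ b ++ c ∷ y₃) →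
            x ++ y ++ z ++ y ++ z′ ≡ (x ++ y₁) ++ a ∷ b ++ c ∷ (y₃ ++ z ++ y ++ z′)
    twice x y₁ a b c y₃ z z′ = begin
      x ++ y ++ z ++ y ++ z′                        ≡⟨ cong (x ++_) (++-assoc y₁ _ _) ⟩
      x ++ y₁ ++ a ∷ (b ++ c ∷ y₃) ++ z ++ y ++ z′  ≡⟨ cong (λ v → x ++ y₁ ++ a ∷ v) (++-assoc b _ _) ⟩
      x ++ y₁ ++ a ∷ b ++ c ∷ (y₃ ++ z ++ y ++ z′)  ≡⟨ ++-assoc x y₁ _ ⟨
      (x ++ y₁) ++ a ∷ b ++ c ∷ (y₃ ++ z ++ y ++ z′) ∎
      where
      open ≡-Reasoning
      y : List A
      y = y₁ ++ a ∷ b ++ c ∷ y₃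

    again : ∀ (y₁ : List A) a b c y₃ z z′ →
            c ∷ y₃ ++ z ++ (y₁ ++ a ∷ b ++ c ∷ y₃) ++ z′ ≡ (c ∷ y₃ ++ z ++ y₁) ++ a ∷ b ++ c ∷ (y₃ ++ z′)
    again y₁ a b c y₃ z z′ = cong (c ∷_) (begin
      y₃ ++ z ++ (y₁ ++ a ∷ b ++ c ∷ y₃) ++ z′    ≡⟨ cong (λ v → y₃ ++ z ++ v) (++-assoc y₁ _ _) ⟩
      y₃ ++ z ++ y₁ ++ a ∷ (b ++ c ∷ y₃) ++ z′    ≡⟨ cong (λ v → y₃ ++ z ++ y₁ ++ a ∷ v) (++-assoc b _ _) ⟩
      y₃ ++ z ++ y₁ ++ a ∷ b ++ c ∷ (y₃ ++ z′)    ≡⟨ cong (y₃ ++_) (++-assoc z y₁ _) ⟨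
      y₃ ++ (z ++ y₁) ++ a ∷ b ++ c ∷ (y₃ ++ z′)  ≡⟨ ++-assoc y₃ (z ++ y₁) _ ⟨
      (y₃ ++ z ++ y₁) ++ a ∷ b ++ c ∷ (y₃ ++ z′)  ∎)
      where open ≡-Reasoning

  -- A word with two markers contains a complete item.
  no-repeats : ∀ {junk is} → Unmarked junk → All Wellformed is → Unique is →
               RepeatsBelow μ 1 (junk ++ flat is)
  no-repeats {junk} {is} uj wf uniq x y z z′ eq with weight μ y ≤? 1
  ... | yes h = h
  ... | no ¬h
    with y₁ , a , y₂ , refl , _ , ma , le ← first-marker y (<⇒≤ (≰⇒> ¬h))
    with b , c , y₃ , refl , ub , mc , _ ← first-marker y₂ (s≤s⁻¹ (≤-trans (≰⇒> ¬h) le))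
    with is₁ , is₂ , refl , eq₂ ← locate (x ++ y₁) junk is uj wf ma ub mc
           (trans eq (twice x y₁ a b c y₃ z z′))
    -- The remainder begins with the closing marker `c`, so nothing unmarked precedes it, and the
    -- second copy of `y` yields the same item within `is₂`.
    with is₃ , is₄ , refl , _ ← locate (c ∷ y₃ ++ z ++ y₁) [] is₂ {z = y₃ ++ z′} []
           (All.tail (All.++⁻ʳ is₁ wf)) ma ub mc (trans eq₂ (again y₁ a b c y₃ z z′)) =
    contradiction uniq (unique-once is₁ is₃)

-- Binary expansions, least significant bit first

-- `q` is the part above the listed digits, that is, the number of copies left after as many
-- halvings.
value : List Bool → ℕ → ℕ
value []       q = q
value (β ∷ βs) q = bit β + (value βs q + value βs q)

spell : ℕ → List Bool → List Label → List Label
spell j []       l = l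
spell j (β ∷ βs) l = spell (suc j) βs (replicate (bit β) (pw j) ++ l)

⌊bit+2n/2⌋ : ∀ β n → ⌊ bit β + (n + n) /2⌋ ≡ n
⌊bit+2n/2⌋ false n = sym (n≡⌊n+n/2⌋ n)
⌊bit+2n/2⌋ true  n = sym (n≡⌈n+n/2⌉ n)

lowBit[bit+2n] : ∀ β n → lowBit (bit β + (n + n)) ≡ bit β
lowBit[bit+2n] false zero    = refl
lowBit[bit+2n] true  zero    = refl
lowBit[bit+2n] false (suc n) = trans (cong (λ m → lowBit (1 + m)) (+-suc n n)) (lowBit[bit+2n] false n)
lowBit[bit+2n] true  (suc n) = trans (cong (λ m → lowBit (2 + m)) (+-suc n n)) (lowBit[bit+2n] true n)

n≡lowBit+2⌊n/2⌋ : ∀ n → n ≡ lowBit n + (⌊ n /2⌋ + ⌊ n /2⌋)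
n≡lowBit+2⌊n/2⌋ zero          = refl
n≡lowBit+2⌊n/2⌋ (suc zero)    = refl
n≡lowBit+2⌊n/2⌋ (suc (suc n)) = trans (cong (2 +_) (n≡lowBit+2⌊n/2⌋ n)) (shift (lowBit n) ⌊ n /2⌋)
  where
  shift : ∀ x y → 2 + (x + (y + y)) ≡ x + ((1 + y) + (1 + y))
  shift = solve-∀

halveRun : ℕ → ℕ → Run → Run
halveRun zero    j r = r
halveRun (suc i) j r = halveRun i (suc j) (halfRun j r)

halve-map : ∀ i j rs → halve i j rs ≡ map (halveRun i j) rs
halve-map zero    j rs = sym (map-id rs)
halve-map (suc i) j rs = trans (halve-map i (suc j) (map (halfRun j) rs)) (sym (map-∘ rs))

halveRun-value : ∀ βs j q l → halveRun (length βs) j (value βs q , l) ≡ (q , spell j βs l)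
halveRun-value []       j q l = refl
halveRun-value (β ∷ βs) j q l
  rewrite ⌊bit+2n/2⌋ β (value βs q) | lowBit[bit+2n] β (value βs q) =
  halveRun-value βs (suc j) q (replicate (bit β) (pw j) ++ l)

value-++ : ∀ βs γs q → value (βs ++ γs) q ≡ value βs (value γs q)
value-++ []       γs q = refl
value-++ (β ∷ βs) γs q = cong (λ n → bit β + (n + n)) (value-++ βs γs q)

value-carry : ∀ βs q → value βs q ≡ value βs 0 + 2 ^ length βs * q
value-carry []       q = sym (+-identityʳ q)
value-carry (β ∷ βs) q = trans (cong (λ n → bit β + (n + n)) (value-carry βs q))
  (shuffle (bit β) (value βs 0) (2 ^ length βs) q)
  where
  shuffle : ∀ b x y q → b + (x + y * q + (x + y * q)) ≡ b + (x + x) + 2 * y * q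
  shuffle = solve-∀

spell-prefix : ∀ j βs l → spell j βs l ≡ spell j βs [] ++ l
spell-prefix j []       l = refl
spell-prefix j (β ∷ βs) l = begin
  spell (suc j) βs (b ++ l)                ≡⟨ spell-prefix (suc j) βs (b ++ l) ⟩
  spell (suc j) βs [] ++ b ++ l            ≡⟨ ++-assoc (spell (suc j) βs []) b l ⟨
  (spell (suc j) βs [] ++ b) ++ l          ≡⟨ cong (_++ l) (spell-prefix (suc j) βs b) ⟨
  spell (suc j) βs b ++ l                  ≡⟨ cong (λ b → spell (suc j) βs b ++ l) (++-identityʳ b) ⟨
  spell (suc j) βs (b ++ []) ++ l          ∎
  where
  open ≡-Reasoning
  b : List Label
  b = replicate (bit β) (pw j)

spell-++ : ∀ j βs γs l → spell j (βs ++ γs) l ≡ spell (length βs + j) γs (spell j βs l)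
spell-++ j []       γs l = refl
spell-++ j (β ∷ βs) γs l = trans (spell-++ (suc j) βs γs _)
  (cong (λ i → spell i γs (spell (suc j) βs (replicate (bit β) (pw j) ++ l))) (+-suc (length βs) j))

all-bit : {P : Label → Set} {j : ℕ} (β : Bool) → P (pw j) → {l : List Label} → All P l →
          All P (replicate (bit β) (pw j) ++ l)
all-bit false p ps = ps
all-bit true  p ps = p ∷ ps

spell-all : {P : Label → Set} → ∀ j βs {l} → (∀ i → i < length βs → P (pw (i + j))) → All P l →
            All P (spell j βs l)
spell-all         j []       h ps = ps
spell-all {P = P} j (β ∷ βs) h ps = spell-all (suc j) βs
  (λ i i< → subst (P ∘ pw) (sym (+-suc i j)) (h (suc i) (s≤s i<)))
  (all-bit β (h 0 (s≤s z≤n)) ps)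

-- The length of the word that a label derives. Weighing by it reads a number back from its spelled
-- digits, which makes spelling injective.
units : Label → ℕ
units (pw j) = 2 ^ j
units sep    = 1

spell-units : ∀ j βs l → weight units (spell j βs l) ≡ 2 ^ j * value βs 0 + weight units l
spell-units j []       l = cong (_+ weight units l) (sym (*-zeroʳ (2 ^ j)))
spell-units j (β ∷ βs) l = begin
  weight units (spell (suc j) βs (replicate (bit β) (pw j) ++ l))
    ≡⟨ spell-units (suc j) βs _ ⟩
  2 * 2 ^ j * value βs 0 + weight units (replicate (bit β) (pw j) ++ l)
    ≡⟨ cong (2 * 2 ^ j * value βs 0 +_) (trans (weight-++ units (replicate (bit β) (pw j)) l)
         (cong (_+ weight units l) (weight-replicate units (bit β) (pw j)))) ⟩
  2 * 2 ^ j * value βs 0 + (bit β * 2 ^ j + weight units l)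
    ≡⟨ shuffle (2 ^ j) (value βs 0) (bit β) (weight units l) ⟩
  2 ^ j * (bit β + (value βs 0 + value βs 0)) + weight units l ∎
  where
  open ≡-Reasoning
  shuffle : ∀ x y b z → 2 * x * y + (b * x + z) ≡ x * (b + (y + y)) + z
  shuffle = solve-∀

digits : ℕ → ℕ → List Bool
digits zero    i = []
digits (suc v) i = odd i ∷ digits v ⌊ i /2⌋

length-digits : ∀ v i → length (digits v i) ≡ v
length-digits zero    i = refl
length-digits (suc v) i = cong suc (length-digits v ⌊ i /2⌋)

⌊n/2⌋<2^ : ∀ L {n} → n < 2 ^ suc L → ⌊ n /2⌋ < 2 ^ L
⌊n/2⌋<2^ L {n} h = ≰⇒> λ le → <⇒≱ h (begin
  2 ^ L + (2 ^ L + 0)              ≡⟨ cong (2 ^ L +_) (+-identityʳ (2 ^ L)) ⟩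
  2 ^ L + 2 ^ L                    ≤⟨ +-mono-≤ le le ⟩
  ⌊ n /2⌋ + ⌊ n /2⌋                ≤⟨ m≤n+m _ (lowBit n) ⟩
  lowBit n + (⌊ n /2⌋ + ⌊ n /2⌋)   ≡⟨ n≡lowBit+2⌊n/2⌋ n ⟨
  n                                ∎)
  where open ≤-Reasoning

value-digits : ∀ v i → i < 2 ^ v → value (digits v i) 0 ≡ i
value-digits zero    zero    h = refl
value-digits zero    (suc i) (s≤s ())
value-digits (suc v) i h = begin
  lowBit i + (value (digits v ⌊ i /2⌋) 0 + value (digits v ⌊ i /2⌋) 0)
    ≡⟨ cong (λ n → lowBit i + (n + n)) (value-digits v ⌊ i /2⌋ (⌊n/2⌋<2^ v h)) ⟩
  lowBit i + (⌊ i /2⌋ + ⌊ i /2⌋)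
    ≡⟨ n≡lowBit+2⌊n/2⌋ i ⟨
  i ∎
  where
  open ≡-Reasoning

⌊_/4⌋ : ℕ → ℕ
⌊ n /4⌋ = ⌊ ⌊ n /2⌋ /2⌋

-- The bits at odd positions are those at even positions of ⌊ n /2⌋.
evenDigits : ℕ → ℕ → List Bool
evenDigits zero    n = []
evenDigits (suc h) n = odd n ∷ false ∷ evenDigits h ⌊ n /4⌋

⌊_/4^_⌋ : ℕ → ℕ → ℕ
⌊ n /4^ zero  ⌋ = n
⌊ n /4^ suc h ⌋ = ⌊ ⌊ n /4⌋ /4^ h ⌋

length-evenDigits : ∀ h n → length (evenDigits h n) ≡ h * 2
length-evenDigits zero    n = refl
length-evenDigits (suc h) n = cong (2 +_) (length-evenDigits h ⌊ n /4⌋)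

-- Everything above the lowest `2 * h` bits goes to `evenPart`, where it becomes the reserve of
-- copies that keeps pairing frequent. `oddPart` is half the value of the odd-position bits.
evenPart oddPart : ℕ → ℕ → ℕ
evenPart h n = value (evenDigits h n) ⌊ n /4^ h ⌋
oddPart  h n = value (evenDigits h ⌊ n /2⌋) 0

evenPart+2oddPart : ∀ h n → evenPart h n + (oddPart h n + oddPart h n) ≡ n
evenPart+2oddPart zero    n = +-identityʳ n
evenPart+2oddPart (suc h) n = begin
  lowBit n + (E + E + (E + E)) + (lowBit n/2 + (M + M + (M + M)) + (lowBit n/2 + (M + M + (M + M))))
    ≡⟨ shuffle (lowBit n) (lowBit n/2) E M ⟩
  lowBit n + ((lowBit n/2 + (E + (M + M) + (E + (M + M)))) + (lowBit n/2 + (E + (M + M) + (E + (M + M)))))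
    ≡⟨ cong (λ x → lowBit n + ((lowBit n/2 + (x + x)) + (lowBit n/2 + (x + x))))
            (evenPart+2oddPart h ⌊ n /4⌋) ⟩
  lowBit n + ((lowBit n/2 + (⌊ n /4⌋ + ⌊ n /4⌋)) + (lowBit n/2 + (⌊ n /4⌋ + ⌊ n /4⌋)))
    ≡⟨ cong (λ x → lowBit n + (x + x)) (n≡lowBit+2⌊n/2⌋ n/2) ⟨
  lowBit n + (n/2 + n/2)
    ≡⟨ n≡lowBit+2⌊n/2⌋ n ⟨
  n ∎
  where
  open ≡-Reasoning
  n/2 E M : ℕ
  n/2 = ⌊ n /2⌋
  E = evenPart h ⌊ n /4⌋
  M = oddPart h ⌊ n /4⌋
  shuffle : ∀ a b e m →
    a + (e + e + (e + e)) + (b + (m + m + (m + m)) + (b + (m + m + (m + m)))) ≡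
    a + ((b + (e + (m + m) + (e + (m + m)))) + (b + (e + (m + m) + (e + (m + m)))))
  shuffle = solve-∀

≤⌊/4^⌋ : ∀ h {n q} → 2 ^ (h * 2) * q ≤ n → q ≤ ⌊ n /4^ h ⌋
≤⌊/4^⌋ zero    {n} {q} le = ≤-trans (≤-reflexive (sym (+-identityʳ q))) le
≤⌊/4^⌋ (suc h) {n} {q} le = ≤⌊/4^⌋ h (halved (halved (≤-trans (≤-reflexive (shuffle (2 ^ (h * 2)) q)) le)))
  where
  halved : ∀ {x n} → x + x ≤ n → x ≤ ⌊ n /2⌋
  halved {x} le = ≤-trans (≤-reflexive (n≡⌊n+n/2⌋ x)) (⌊n/2⌋-mono le)
  shuffle : ∀ x q → x * q + x * q + (x * q + x * q) ≡ 2 * (2 * x) * q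
  shuffle = solve-∀

spell-even-all : {P : Label → Set} → (∀ i → P (pw (2 * i))) → ∀ i h n {l} → All P l →
                 All P (spell (2 * i) (evenDigits h n) l)
spell-even-all         even i zero    n ps = ps
spell-even-all {P = P} even i (suc h) n {l} ps =
  subst (λ j → All P (spell j (evenDigits h ⌊ n /4⌋) (replicate (lowBit n) (pw (2 * i)) ++ l)))
    (*-suc 2 i) (spell-even-all even (suc i) h ⌊ n /4⌋ (all-bit (odd n) (even i) ps))

-- The extra copy comes last, as the most significant block, so induction peels off the block that
-- `downFrom` lists first.
repeat : ℕ → List Bool → List Bool
repeat zero    βs = []
repeat (suc T) βs = repeat T βs ++ βs

length-repeat : ∀ T βs → length (repeat T βs) ≡ T * length βs
length-repeat zero    βs = refl
length-repeat (suc T) βs = trans (length-++ (repeat T βs))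
  (trans (cong (_+ length βs) (length-repeat T βs)) (+-comm _ (length βs)))

-- The common difference of the progression of run lengths.
geometric : ℕ → ℕ → ℕ
geometric w zero    = 0
geometric w (suc T) = geometric w T + 2 ^ (T * w)

value-repeat : ∀ T βs → value (repeat T βs) 0 ≡ value βs 0 * geometric (length βs) T
value-repeat zero    βs = sym (*-zeroʳ (value βs 0))
value-repeat (suc T) βs = begin
  value (repeat T βs ++ βs) 0
    ≡⟨ trans (value-++ (repeat T βs) βs 0) (value-carry (repeat T βs) (value βs 0)) ⟩
  value (repeat T βs) 0 + 2 ^ length (repeat T βs) * value βs 0
    ≡⟨ cong₂ _+_ (value-repeat T βs) (cong (λ i → 2 ^ i * value βs 0) (length-repeat T βs)) ⟩
  value βs 0 * geometric w T + 2 ^ (T * w) * value βs 0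
    ≡⟨ shuffle (value βs 0) (geometric w T) (2 ^ (T * w)) ⟩
  value βs 0 * (geometric w T + 2 ^ (T * w)) ∎
  where
  open ≡-Reasoning
  w : ℕ
  w = length βs
  shuffle : ∀ x y z → x * y + z * x ≡ x * (y + z)
  shuffle = solve-∀

-- Words given by run lengths

render : ℕ → List Run → List Label
render j = concatMap (λ (q , l) → replicate q (pw j) ++ l)

text-render : {A : Set} {label : A → Label} {top : A} {j : ℕ} → label top ≡ pw j →
              ∀ {rs u} → Text label top rs u → map label u ≡ render j rs
text-render eq [] = refl
text-render {label = label} {top} {j} eq (run {x} {t} {rs} {u} q _ txt) = begin
  map label (replicate q top ++ x ∷ t ++ u)
    ≡⟨ map-++ label (replicate q top) _ ⟩
  map label (replicate q top) ++ map label ((x ∷ t) ++ u)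
    ≡⟨ cong₂ _++_ (trans (map-replicate label q top) (cong (replicate q) eq)) (map-++ label (x ∷ t) u) ⟩
  replicate q (pw j) ++ map label (x ∷ t) ++ map label u
    ≡⟨ cong (λ v → replicate q (pw j) ++ map label (x ∷ t) ++ v) (text-render eq txt) ⟩
  replicate q (pw j) ++ map label (x ∷ t) ++ render j rs
    ≡⟨ ++-assoc (replicate q (pw j)) _ _ ⟨
  (replicate q (pw j) ++ map label (x ∷ t)) ++ render j rs ∎
  where open ≡-Reasoning

unary : List ℕ → List (Fin 2)
unary = concatMap (λ b → replicate b zero ++ [ suc zero ])

length-unary-∷ : ∀ b bs → length (unary (b ∷ bs)) ≡ suc b + length (unary bs)
length-unary-∷ b bs = begin
  length ((replicate b zero ++ [ suc zero ]) ++ unary bs)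
    ≡⟨ length-++ (replicate b zero ++ [ suc zero ]) ⟩
  length (replicate b zero ++ [ suc zero ]) + length (unary bs)
    ≡⟨ cong (_+ length (unary bs)) (length-++ (replicate b zero)) ⟩
  length (replicate b zero) + 1 + length (unary bs)
    ≡⟨ cong (_+ length (unary bs)) (trans (cong (_+ 1) (length-replicate b)) (+-comm b 1)) ⟩
  suc b + length (unary bs) ∎
  where open ≡-Reasoning

bare : ℕ → Run
bare b = b , [ sep ]

-- The value at the nonterminal is a default; the trivial rule contains letters only.
letter : Symbol 1 2 → Label
letter (inj₁ _)       = sep
letter (inj₂ zero)    = pw 0
letter (inj₂ (suc _)) = sep

text-unary : ∀ bs → Text letter (inj₂ zero) (map bare bs) (map inj₂ (unary bs))
text-unary []       = []
text-unary (b ∷ bs) = subst (Text letter (inj₂ zero) (map bare (b ∷ bs))) (sym spelled)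
  (run {x = inj₂ (suc zero)} {t = []} b ((λ ()) ∷ []) (text-unary bs))
  where
  spelled : map inj₂ ((replicate b zero ++ [ suc zero ]) ++ unary bs) ≡
            replicate b (inj₂ zero) ++ inj₂ (suc zero) ∷ map inj₂ (unary bs)
  spelled = begin
    map inj₂ ((replicate b zero ++ [ suc zero ]) ++ unary bs)
      ≡⟨ cong (map inj₂) (++-assoc (replicate b zero) _ _) ⟩
    map inj₂ (replicate b zero ++ suc zero ∷ unary bs)
      ≡⟨ map-++ inj₂ (replicate b zero) _ ⟩
    map inj₂ (replicate b zero) ++ inj₂ (suc zero) ∷ map inj₂ (unary bs)
      ≡⟨ cong (_++ inj₂ (suc zero) ∷ map inj₂ (unary bs)) (map-replicate inj₂ b zero) ⟩
    replicate b (inj₂ zero) ++ inj₂ (suc zero) ∷ map inj₂ (unary bs) ∎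
    where open ≡-Reasoning

stage-trivial : ∀ (w : List⁺ (Fin 2)) bs → toList w ≡ unary bs → Stage 0 (map bare bs) (trivial w)
stage-trivial w bs eq = record
  { label     = letter
  ; top       = inj₂ zero
  ; label-top = refl
  ; text      = subst (Text letter (inj₂ zero) (map bare bs) ∘ map inj₂) (sym eq) (text-unary bs)
  ; short     = λ { zero A≢S → contradiction refl A≢S }
  ; below     = λ { zero A≢S → contradiction refl A≢S }
  }

concatMap-singleton : {A B : Set} (f : A → B) → ∀ u → concatMap ([_] ∘ f) u ≡ map f u
concatMap-singleton f u = trans (sym (concatMap-map [_] f u)) (concatMap-pure (map f u))

-- The bound is 2 because a rule of the first phase has two symbols, each with at most one marker.
stage-refines : {μ : Label → ℕ} → (∀ a → μ a ≤ 1) → ∀ {k j rs} {G : Grammar k} → Stage j rs G →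
                Refines μ 2 (render j rs) G
stage-refines {μ} μ≤1 {G = G} st = record
  { meaning       = [_] ∘ label
  ; light-symbols = λ s → ≤-trans (≤-reflexive (+-identityʳ _)) (≤-trans (μ≤1 (label s)) (s≤s z≤n))
  ; light-rules   = λ A A≢S → begin
      weight μ (concatMap ([_] ∘ label) (rhs A))  ≡⟨ cong (weight μ) (concatMap-singleton label (rhs A)) ⟩
      weight μ (map label (rhs A))                ≤⟨ weight≤length μ≤1 (map label (rhs A)) ⟩
      length (map label (rhs A))                  ≡⟨ length-map label (rhs A) ⟩
      length (rhs A)                              ≤⟨ short A A≢S ⟩
      2                                           ∎
  ; text          = trans (concatMap-singleton label (rhs start)) (text-render label-top text)
  }
  where
  open Stage st
  open Grammar G
  open ≤-Reasoning hiding (start)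

-- The hard words and RePair's output

-- Here m = 1 + p, and the low v bits of a block hold i.
module Construction (p : ℕ) where

  v w : ℕ
  v = suc (2 * p)
  w = suc v

  -- Levels count from 0, so `w ∣ suc j` singles out the top positions `v + t * w` of the blocks.
  marker : Label → ℕ
  marker sep = 0
  marker (pw j) with w ∣? suc j
  ... | yes _ = 1
  ... | no  _ = 0

  marker≤1 : ∀ a → marker a ≤ 1
  marker≤1 sep = z≤n
  marker≤1 (pw j) with w ∣? suc j
  ... | yes _ = ≤-refl
  ... | no  _ = z≤n

  unmarked : ∀ {j} → ¬ w ∣ suc j → marker (pw j) ≡ 0
  unmarked {j} w∤ with w ∣? suc j
  ... | yes w∣ = contradiction w∣ w∤
  ... | no _   = refl

  open Marked marker marker≤1

  w≡2[1+p] : w ≡ 2 * suc p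
  w≡2[1+p] = sym (*-suc 2 p)

  -- As `w` is even, a marker at level `2 * i` would make 2 divide `suc (2 * i)`.
  even-unmarked : ∀ i → marker (pw (2 * i)) ≡ 0
  even-unmarked i = unmarked λ w∣ → contradiction
    (∣m+n∣m⇒∣n (subst (2 ∣_) (+-comm 1 (2 * i)) (∣-trans 2∣w w∣)) (m∣m*n i))
    (>⇒∤ (s≤s (s≤s z≤n)))
    where
    2∣w : 2 ∣ w
    2∣w = subst (2 ∣_) (sym w≡2[1+p]) (m∣m*n (suc p))

  inner-unmarked : ∀ t i → i < v → marker (pw (i + t * w)) ≡ 0
  inner-unmarked t i i<v = unmarked λ w∣ →
    >⇒∤ (s≤s i<v) (∣m+n∣m⇒∣n (subst (w ∣_) (+-comm (suc i) (t * w)) w∣) (n∣m*n t))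

  block-marked : ∀ t → marker (pw (v + t * w)) ≢ 0
  block-marked t with w ∣? suc (v + t * w)
  ... | yes _ = λ ()
  ... | no w∤ = contradiction (divides (suc t) refl) w∤

  block : ℕ → List Bool
  block i = digits v i ++ [ true ]

  length-block : ∀ i → length (block i) ≡ w
  length-block i = trans (length-++ (digits v i)) (trans (cong (_+ 1) (length-digits v i)) (+-comm v 1))

  value-block : ∀ {i} → i < 2 ^ v → value (block i) 0 ≡ i + 2 ^ v
  value-block {i} i< = begin
    value (digits v i ++ [ true ]) 0
      ≡⟨ trans (value-++ (digits v i) _ 0) (value-carry (digits v i) 1) ⟩
    value (digits v i) 0 + 2 ^ length (digits v i) * 1
      ≡⟨ cong₂ _+_ (value-digits v i i<) (trans (*-identityʳ _) (cong (2 ^_) (length-digits v i))) ⟩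
    i + 2 ^ v                                     ∎
    where open ≡-Reasoning

  -- The letter 1 that ends a run belongs to the body of its lowest item. In `spell-blocks` the same
  -- function covers the expansion without blocks, which is that letter alone.
  base : ℕ → List Label
  base zero    = [ sep ]
  base (suc _) = []

  item : ℕ → ℕ → Item
  item i t = pw (v + t * w) , spell (t * w) (digits v i) (base t)

  item-wellformed : ∀ i t → Wellformed (item i t)
  item-wellformed i t = block-marked t , spell-all (t * w) (digits v i)
    (λ s s< → inner-unmarked t s (subst (s <_) (length-digits v i) s<)) (base-unmarked t)
    where
    base-unmarked : ∀ t → Unmarked (base t)
    base-unmarked zero    = refl ∷ []
    base-unmarked (suc _) = []

  pw-injective : ∀ {i j} → pw i ≡ pw j → i ≡ j
  pw-injective refl = refl

  -- The marker reveals `t`; the weight of the body under `units` then reveals `i`, which fits into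
  -- `v` digits.
  item-injective : ∀ {i i′ t t′} → i < 2 ^ v → i′ < 2 ^ v → item i t ≡ item i′ t′ → i ≡ i′ × t ≡ t′
  item-injective {i} {i′} {t} {t′} i< i′< eq
    with refl ← *-cancelʳ-≡ t t′ w (+-cancelˡ-≡ v (t * w) (t′ * w) (pw-injective (,-injectiveˡ eq))) =
    *-cancelˡ-≡ i i′ (2 ^ (t * w)) {{m^n≢0 2 (t * w)}} (+-cancelʳ-≡ (weight units (base t)) _ _ (begin
      2 ^ (t * w) * i + weight units (base t)                 ≡⟨ decode i i< ⟨
      weight units (spell (t * w) (digits v i) (base t))      ≡⟨ cong (weight units) (,-injectiveʳ eq) ⟩
      weight units (spell (t * w) (digits v i′) (base t))     ≡⟨ decode i′ i′< ⟩
      2 ^ (t * w) * i′ + weight units (base t)                ∎)) , refl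
    where
    open ≡-Reasoning
    decode : ∀ i → i < 2 ^ v → weight units (spell (t * w) (digits v i) (base t)) ≡
                               2 ^ (t * w) * i + weight units (base t)
    decode i i< = trans (spell-units (t * w) (digits v i) (base t))
      (cong (λ n → 2 ^ (t * w) * n + weight units (base t)) (value-digits v i i<))

  spell-blocks : ∀ i T → spell 0 (repeat T (block i)) [ sep ] ≡ base T ++ flat (map (item i) (downFrom T))
  spell-blocks i zero    = refl
  spell-blocks i (suc T) = begin
    spell 0 (repeat T (block i) ++ block i) [ sep ]
      ≡⟨ spell-++ 0 (repeat T (block i)) (block i) [ sep ] ⟩
    spell (length (repeat T (block i)) + 0) (block i) (spell 0 (repeat T (block i)) [ sep ])
      ≡⟨ cong₂ (λ j l → spell j (block i) l) level (spell-blocks i T) ⟩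
    spell (T * w) (digits v i ++ [ true ]) (base T ++ F)
      ≡⟨ spell-++ (T * w) (digits v i) [ true ] _ ⟩
    pw (length (digits v i) + T * w) ∷ spell (T * w) (digits v i) (base T ++ F)
      ≡⟨ cong₂ (λ j l → pw (j + T * w) ∷ l) (length-digits v i) appended ⟩
    pw (v + T * w) ∷ spell (T * w) (digits v i) (base T) ++ F ∎
    where
    open ≡-Reasoning
    F : List Label
    F = flat (map (item i) (downFrom T))
    level : length (repeat T (block i)) + 0 ≡ T * w
    level = trans (+-identityʳ _) (trans (length-repeat T (block i)) (cong (T *_) (length-block i)))
    appended : spell (T * w) (digits v i) (base T ++ F) ≡ spell (T * w) (digits v i) (base T) ++ F
    appended = begin
      spell (T * w) (digits v i) (base T ++ F)              ≡⟨ spell-prefix (T * w) (digits v i) _ ⟩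
      spell (T * w) (digits v i) [] ++ base T ++ F          ≡⟨ ++-assoc (spell (T * w) (digits v i) []) _ _ ⟨
      (spell (T * w) (digits v i) [] ++ base T) ++ F
        ≡⟨ cong (_++ F) (spell-prefix (T * w) (digits v i) (base T)) ⟨
      spell (T * w) (digits v i) (base T) ++ F              ∎

  module Word (T′ K : ℕ) (K≤2^v : K ≤ 2 ^ v) where

    T h J : ℕ
    -- A positive `T` makes `base T` empty, so every run spelled by blocks starts with a marker.
    T = suc T′
    h = T * suc p
    J = T * w

    h*2≡J : h * 2 ≡ J
    h*2≡J = trans (*-assoc T (suc p) 2) (cong (T *_) (trans (*-comm (suc p) 2) (sym w≡2[1+p])))

    code : ℕ → ℕ
    code i = value (repeat T (block i)) 0

    code-≡ : ∀ {i} → i < K → code i ≡ (i + 2 ^ v) * geometric w T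
    code-≡ {i} i<K = trans (value-repeat T (block i))
      (cong₂ (λ x y → x * geometric y T) (value-block (<-≤-trans i<K K≤2^v)) (length-block i))

    items : List Item
    items = cartesianProductWith item (upTo K) (downFrom T)

    items-unique : Unique items
    items-unique = unique-product item
      (λ p q → item-injective (<-≤-trans (∈-upTo⁻ p) K≤2^v) (<-≤-trans (∈-upTo⁻ q) K≤2^v))
      (Unique.upTo⁺ K) (Unique.downFrom⁺ T)

    items-wellformed : All Wellformed items
    items-wellformed = All.tabulate wellformed
      where
      wellformed : ∀ {it} → it ∈ items → Wellformed it
      wellformed it∈ with i , t , _ , _ , refl ← ∈-cartesianProductWith⁻ item (upTo K) (downFrom T) it∈ =
        item-wellformed i t

    length-product : ∀ xs ts → length (cartesianProductWith item xs ts) ≡ length xs * length ts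
    length-product []       ts = refl
    length-product (i ∷ xs) ts = trans (length-++ (map (item i) ts))
      (cong₂ _+_ (length-map (item i) ts) (length-product xs ts))

    length≤markers : ∀ {is} → All Wellformed is → length is ≤ weight marker (flat is)
    length≤markers []                     = z≤n
    length≤markers {(a , b) ∷ is} ((ma , _) ∷ wf) = begin
      1 + length is
        ≤⟨ +-mono-≤ (n≢0⇒n>0 ma) (length≤markers wf) ⟩
      marker a + weight marker (flat is)
        ≤⟨ +-monoʳ-≤ (marker a) (m≤n+m _ (weight marker b)) ⟩
      marker a + (weight marker b + weight marker (flat is))
        ≡⟨ cong (marker a +_) (weight-++ marker b (flat is)) ⟨
      marker a + weight marker (b ++ flat is) ∎
      where open ≤-Reasoning

    lengths : ℕ → List ℕ
    lengths N = evenPart h N ∷ oddPart h N ∷ oddPart h N ∷ map code (upTo K)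

    padding : ℕ → List Run
    padding N = (⌊ N /4^ h ⌋ , spell 0 (evenDigits h N) [ sep ]) ∷
                (0 , spell 0 (evenDigits h ⌊ N /2⌋) [ sep ]) ∷
                (0 , spell 0 (evenDigits h ⌊ N /2⌋) [ sep ]) ∷ []

    spelled : ℕ → Run
    spelled i = 0 , flat (map (item i) (downFrom T))

    -- Each length is a `value` of exactly `J` digits, so `J` halvings spell it completely; only the
    -- first run keeps copies, namely its carry.
    halve-lengths : ∀ N → halve J 0 (map bare (lengths N)) ≡ padding N ++ map spelled (upTo K)
    halve-lengths N = trans (halve-map J 0 (map bare (lengths N)))
      (cong₂ _∷_ (even-run N ⌊ N /4^ h ⌋)
        (cong₂ _∷_ (even-run ⌊ N /2⌋ 0) (cong₂ _∷_ (even-run ⌊ N /2⌋ 0) codes)))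
      where
      halved : ∀ βs q → length βs ≡ J → halveRun J 0 (bare (value βs q)) ≡ (q , spell 0 βs [ sep ])
      halved βs q eq = subst (λ i → halveRun i 0 (bare (value βs q)) ≡ (q , spell 0 βs [ sep ])) eq
        (halveRun-value βs 0 q [ sep ])
      even-run : ∀ n q → halveRun J 0 (bare (value (evenDigits h n) q)) ≡
                         (q , spell 0 (evenDigits h n) [ sep ])
      even-run n q = halved (evenDigits h n) q (trans (length-evenDigits h n) h*2≡J)
      code-run : ∀ i → halveRun J 0 (bare (code i)) ≡ spelled i
      code-run i = trans
        (halved (repeat T (block i)) 0 (trans (length-repeat T (block i)) (cong (T *_) (length-block i))))
        (cong (0 ,_) (spell-blocks i T))
      codes : map (halveRun J 0) (map bare (map code (upTo K))) ≡ map spelled (upTo K)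
      codes = trans (sym (map-∘ (map code (upTo K))))
        (trans (sym (map-∘ (upTo K))) (map-cong code-run (upTo K)))

    render-spelled : ∀ xs → render J (map spelled xs) ≡ flat (cartesianProductWith item xs (downFrom T))
    render-spelled []       = refl
    render-spelled (i ∷ xs) = trans (cong (flat (map (item i) (downFrom T)) ++_) (render-spelled xs))
      (sym (concatMap-++ (uncurry _∷_) (map (item i) (downFrom T)) _))

    render-lengths : ∀ N → render J (halve J 0 (map bare (lengths N))) ≡ render J (padding N) ++ flat items
    render-lengths N = trans (cong (render J) (halve-lengths N))
      (trans (concatMap-++ _ (padding N) (map spelled (upTo K)))
             (cong (render J (padding N) ++_) (render-spelled (upTo K))))

    padding-unmarked : ∀ N → Unmarked (render J (padding N))
    padding-unmarked N =
      All.++⁺ (All.++⁺ (All.replicate⁺ ⌊ N /4^ h ⌋ top-unmarked) (even-run N))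
        (All.++⁺ (even-run ⌊ N /2⌋) (All.++⁺ (even-run ⌊ N /2⌋) []))
      where
      -- The leftover copies have level `J`, which equals `2 * h` and is even.
      top-unmarked : marker (pw J) ≡ 0
      top-unmarked = subst (λ j → marker (pw j) ≡ 0) (trans (*-comm 2 h) h*2≡J) (even-unmarked h)
      even-run : ∀ n → Unmarked (spell 0 (evenDigits h n) [ sep ])
      even-run n = spell-even-all even-unmarked 0 h n (refl ∷ [])

    -- The left side of the budget condition in `phase₁`, for `J` rounds on `3 + K` runs, one
    -- nonterminal and one separating letter per run.
    budget : ℕ
    budget = J * (5 + K) + (5 + K)

    large-output : ∀ (τ : TieBreaking) N (u : List⁺ (Fin 2)) {H} → toList u ≡ unary (lengths N) →
                   budget < ⌊ N /4^ h ⌋ → RePairRun τ (trivial u) H → K * T ≤ size H * 2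
    large-output τ N u {H} eq enough runs = begin
        K * T                                              ≡⟨ cong₂ _*_ (length-upTo K) (length-downFrom T) ⟨
        length (upTo K) * length (downFrom T)              ≡⟨ length-product (upTo K) (downFrom T) ⟨
        length items                                       ≤⟨ length≤markers items-wellformed ⟩
        weight marker (flat items)                         ≤⟨ m≤n+m _ _ ⟩
        weight marker (render J (padding N)) + weight marker (flat items)
          ≡⟨ weight-++ marker (render J (padding N)) (flat items) ⟨
        weight marker (render J (padding N) ++ flat items) ≤⟨ refines-size final ⟩
        size H * 2                                         ∎
      where
      open ≤-Reasoning
      #lengths : length (lengths N) ≡ 3 + K
      #lengths = cong (3 +_) (trans (length-map code (upTo K)) (length-upTo K))
      #runs : length (map bare (lengths N)) ≡ 3 + K
      #runs = trans (length-map bare (lengths N)) #lengths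
      tails-bare : ∀ bs → tails (map bare bs) ≡ length bs
      tails-bare []       = refl
      tails-bare (_ ∷ bs) = cong suc (tails-bare bs)
      -- Relaxed from 1 to 2 to agree with the bound on the pair rules of the first phase.
      rep : RepeatsBelow marker 2 (render J (padding N) ++ flat items)
      rep x y z z′ eq = ≤-trans
        (no-repeats (padding-unmarked N) items-wellformed items-unique x y z z′ eq) (s≤s z≤n)
      unary-phase : ∃ λ G → Stage (J + 0) (halve J 0 (map bare (lengths N))) G × RePairRun τ G H
      unary-phase = phase₁ τ budget J 0 (map bare (lengths N)) (stage-trivial u (lengths N) eq) runs
        (≤-trans (≤-reflexive #runs) (≤-trans (m≤n+m (3 + K) 2) (m≤n+m (5 + K) (J * (5 + K)))))
        (≤-reflexive (cong₂ (λ m n → J * (2 + m) + (2 + n)) #runs (trans (tails-bare (lengths N)) #lengths)))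
        (subst (λ rs → budget < heads rs) (sym (halve-lengths N)) (≤-trans enough (m≤m+n _ _)))
      final : Refines marker 2 (render J (padding N) ++ flat items) H
      final with G , st , runs′ ← unary-phase = phase₂ rep τ runs′
        (subst (λ u → Refines marker 2 u G) (render-lengths N)
          (stage-refines marker≤1
            (subst (λ j → Stage j (halve J 0 (map bare (lengths N))) G) (+-identityʳ J) st)))

-- Small grammars for the hard words

symbolValue : {n k : ℕ} → (Fin n → List (Fin k)) → Symbol n k → List (Fin k)
symbolValue f = Sum.[ f , [_] ]

concatMap-cong-∈ : {A B : Set} {f g : A → List B} (u : List A) → (∀ {s} → s ∈ u → f s ≡ g s) →
                   concatMap f u ≡ concatMap g u
concatMap-cong-∈ []      h = refl
concatMap-cong-∈ (s ∷ u) h = cong₂ _++_ (h (here refl)) (concatMap-cong-∈ u (h ∘ there))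

-- The words in us are those that further rules may refer to; the empty
-- word, which no nonterminal derives, is allowed among them.
record Program {k : ℕ} (us : List (List (Fin k))) (z : ℕ) : Set where
  field
    {#nt}    : ℕ
    rules    : Vec (List (Symbol #nt k)) #nt
    word    : Fin #nt → List (Fin k)
    solves   : ∀ A → word A ≡ concatMap (symbolValue word) (lookup rules A)
    ordered  : ∀ A {B} → inj₁ B ∈ lookup rules A → A <ᶠ B
    nonempty : ∀ A → lookup rules A ≢ []
    small    : Vec.sum (Vec.map length rules) ≤ z
    defines  : ∀ {u} → u ∈ us → u ≡ [] ⊎ ∃ λ A → word A ≡ u

empty-program : ∀ {k} → Program {k} [] 0
empty-program = record
  { rules = [] ; word = λ () ; solves = λ () ; ordered = λ () ; nonempty = λ ()
  ; small = z≤n ; defines = λ () }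

weaken : ∀ {k us us′ z z′} → (∀ {u} → u ∈ us′ → u ∈ us) → z ≤ z′ → Program {k} us z → Program us′ z′
weaken sub z≤z′ P = record
  { Program P ; small = ≤-trans (Program.small P) z≤z′ ; defines = Program.defines P ∘ sub }

data Available {k : ℕ} (us : List (List (Fin k))) : List (Fin k) → Set where
  terminal  : ∀ a → Available us [ a ]
  defined : ∀ {u} → u ∈ us → Available us u

module _ {k : ℕ} {us : List (List (Fin k))} {z : ℕ} (P : Program us z) where
  open Program P

  -- Empty words have no nonterminal and are left out, so the rule may be shorter than `vs`.
  encode : ∀ {vs} → All (Available us) vs →
           ∃ λ r → concatMap (symbolValue word) r ≡ concat vs × length r ≤ length vs
  encode [] = [] , refl , z≤n
  encode (terminal a ∷ avs) with r , eq , le ← encode avs = inj₂ a ∷ r , cong (a ∷_) eq , s≤s le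
  encode (defined u∈ ∷ avs) with r , eq , le ← encode avs | defines u∈
  ... | inj₁ refl       = r , eq , m≤n⇒m≤1+n le
  ... | inj₂ (A , refl) = inj₁ A ∷ r , cong (word A ++_) eq , s≤s le

  -- The new rule takes index zero, so references always lead to larger indices.
  add-rule : ∀ {u} s r → concatMap (symbolValue word) (s ∷ r) ≡ u → Program (u ∷ us) (suc (length r) + z)
  add-rule {u} s r eq = record
    { rules    = map shift (s ∷ r) ∷ Vec.map (map shift) rules
    ; word    = word′
    ; solves   = λ { zero    → trans (sym eq) (sym (shifted (s ∷ r)))
                   ; (suc A) → trans (solves A) (sym (trans
                       (cong (concatMap (symbolValue word′)) (lookup-map A (map shift) rules))
                       (shifted (lookup rules A)))) }
    ; ordered  = λ { zero B∈ → first (s ∷ r) B∈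
                   ; (suc A) B∈ → later A (subst (_ ∈_) (lookup-map A (map shift) rules) B∈) }
    ; nonempty = λ { zero ()
                   ; (suc A) eq′ → nonempty A (unmapped
                       (trans (sym (lookup-map A (map shift) rules)) eq′)) }
    ; small    = +-mono-≤ (≤-reflexive (length-map shift (s ∷ r)))
        (≤-trans (≤-reflexive (sizes rules)) small)
    ; defines  = λ { (here refl) → inj₂ (zero , refl)
                   ; (there u∈)  → Sum.map₂ (λ (A , eq′) → suc A , eq′) (defines u∈) }
    }
    where
    shift : Symbol #nt k → Symbol (suc #nt) k
    shift = Sum.map₁ suc

    word′ : Fin (suc #nt) → List (Fin k)
    word′ zero    = u
    word′ (suc A) = word A

    shifted : ∀ t → concatMap (symbolValue word′) (map shift t) ≡ concatMap (symbolValue word) t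
    shifted t = trans (concatMap-map (symbolValue word′) shift t)
      (concatMap-cong (λ { (inj₁ _) → refl ; (inj₂ _) → refl }) t)

    first : ∀ t {B} → inj₁ B ∈ map shift t → zero {#nt} <ᶠ B
    first t B∈ with ∈-map⁻ shift B∈
    ... | inj₁ _ , _ , refl = s≤s z≤n

    later : ∀ A {B} → inj₁ B ∈ map shift (lookup rules A) → suc A <ᶠ B
    later A B∈ with ∈-map⁻ shift B∈
    ... | inj₁ _ , B′∈ , refl = s≤s (ordered A B′∈)

    unmapped : ∀ {t} → map shift t ≡ [] → t ≡ []
    unmapped {[]} _ = refl

    sizes : ∀ {m} (rs : Vec (List (Symbol #nt k)) m) →
            Vec.sum (Vec.map length (Vec.map (map shift) rs)) ≡ Vec.sum (Vec.map length rs)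
    sizes []       = refl
    sizes (t ∷ rs) = cong₂ _+_ (length-map shift t) (sizes rs)

  extend : ∀ {vs} → All (Available us) vs → Program (concat vs ∷ us) (length vs + z)
  extend {vs} avs with encode avs
  ... | s ∷ r , eq , le = weaken id (+-monoˡ-≤ z le) (add-rule s r eq)
  -- All parts are empty: their concatenation gets no rule, since productions must be nonempty.
  ... | [] , eq , _ = record
    { Program P
    ; small   = m≤n⇒m≤o+n (length vs) small
    ; defines = λ { (here refl) → inj₁ (sym eq) ; (there u∈) → defines u∈ }
    }

-- Increasing indices exclude cycles, and by well-founded induction `val` agrees with any solution
-- of the equations `solves`.
program⇒SLP : ∀ {k u us z} → Program {k} (u ∷ us) z → u ≢ [] → ∃ λ (𝔸 : SLP k) → val 𝔸 ≡ u × ∣ 𝔸 ∣ ≤ z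
program⇒SLP {k} {u} P u≢[] with Program.defines P (here refl)
... | inj₁ u≡[]       = contradiction u≡[] u≢[]
... | inj₂ (S , S≡u)  = 𝔸 , trans (word-correct S (SLP.wellFounded 𝔸 S)) S≡u , small
  where
  open Program P
  G : Grammar k
  G = grammar rules S

  path-ordered : ∀ {A B} → TransClosure (Grammar._⟶_ G) A B → A <ᶠ B
  path-ordered (edge A⟶B) = ordered _ A⟶B
  path-ordered (A⟶B ∷ p)  = <-trans (ordered _ A⟶B) (path-ordered p)

  𝔸 : SLP k
  𝔸 = slp G (record { nonempty = nonempty ; acyclic = λ A p → <-irrefl refl (path-ordered p) })

  word-correct : ∀ A → Acc (flip (Grammar._⟶_ G)) A → valᴺ 𝔸 A ≡ word A
  word-correct A (acc rec) = trans (valᴺ-unfold 𝔸 A) (trans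
    (concatMap-cong-∈ (lookup rules A) λ
      { {inj₁ B} A⟶B → word-correct B (rec A⟶B)
      ; {inj₂ a} _   → refl })
    (sym (solves A)))

g≤program : ∀ {k us z} (u : List⁺ (Fin k)) → Program (toList u ∷ us) z → g u ≤ z
g≤program u P with 𝔸 , eq , le ← program⇒SLP P (λ ()) = ≤-trans (proj₂ (g-isSmallestSize u) 𝔸 eq) le

zeros : ℕ → List (Fin 2)
zeros n = replicate n zero

zeros-+ : ∀ m n → zeros (m + n) ≡ zeros m ++ zeros n
zeros-+ zero    n = refl
zeros-+ (suc m) n = cong (zero ∷_) (zeros-+ m n)

-- Repeated doubling, with one rule of at most three symbols per binary digit.
power : ∀ {us z} L n → n < 2 ^ L → Program us z → Program (zeros n ∷ us) (3 * L + z)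
power zero    zero    _ P = extend P []
power zero    (suc n) (s≤s ()) P
power {us} {z} (suc L) n n< P = weaken (λ { (here refl) → here doubled ; (there u∈) → there (there u∈) })
  (≤-trans (+-monoˡ-≤ (3 * L + z) (length-step (odd n))) (≤-reflexive (shuffle L z)))
  (extend (power L ⌊ n /2⌋ (⌊n/2⌋<2^ L n<) P) (avs (odd n)))
  where
  h : List (Fin 2)
  h = zeros ⌊ n /2⌋
  step : Bool → List (List (Fin 2))
  step false = h ∷ h ∷ []
  step true  = [ zero ] ∷ h ∷ h ∷ []
  avs : ∀ β → All (Available (h ∷ us)) (step β)
  avs false = defined (here refl) ∷ defined (here refl) ∷ []
  avs true  = terminal zero ∷ defined (here refl) ∷ defined (here refl) ∷ []
  length-step : ∀ β → length (step β) ≤ 3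
  length-step false = s≤s (s≤s z≤n)
  length-step true  = ≤-refl
  concat-step : ∀ β → concat (step β) ≡ zeros (bit β + (⌊ n /2⌋ + ⌊ n /2⌋))
  concat-step false = trans (cong (h ++_) (++-identityʳ h)) (sym (zeros-+ ⌊ n /2⌋ ⌊ n /2⌋))
  concat-step true  = cong (zero ∷_) (concat-step false)
  doubled : zeros n ≡ concat (step (odd n))
  doubled = trans (cong zeros (n≡lowBit+2⌊n/2⌋ n)) (sym (concat-step (odd n)))
  shuffle : ∀ L z → 3 + (3 * L + z) ≡ 3 * suc L + z
  shuffle = solve-∀

-- Each term prepends one copy of the difference to the previous term, at the cost of two symbols.
progression : ∀ {us z} a d → zeros a ∈ us → zeros d ∈ us → ∀ K → Program us z →
              Program (map (λ i → zeros (i * d + a)) (downFrom K) ++ us) (2 * K + z)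
progression a d a∈ d∈ zero P = P
progression {us} {z} a d a∈ d∈ (suc zero) P =
  weaken (λ { (here refl) → here (sym (++-identityʳ (zeros a))) ; (there u∈) → there u∈ }) (n≤1+n _)
    (extend P (defined a∈ ∷ []))
progression {us} {z} a d a∈ d∈ (suc K@(suc i)) P =
  weaken (λ { (here refl) → here next ; (there u∈) → there u∈ }) (≤-reflexive (shuffle K z))
    (extend (progression a d a∈ d∈ K P)
      (defined (∈-++⁺ʳ (map (λ i → zeros (i * d + a)) (downFrom K)) d∈) ∷ defined (here refl) ∷ []))
  where
  next : zeros (d + i * d + a) ≡ zeros d ++ zeros (i * d + a) ++ []
  next = trans (cong zeros (+-assoc d (i * d) a))
    (trans (zeros-+ d (i * d + a)) (cong (zeros d ++_) (sym (++-identityʳ (zeros (i * d + a))))))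
  shuffle : ∀ K z → 2 + (2 * K + z) ≡ 2 * suc K + z
  shuffle = solve-∀

unary-program : ∀ {us z} bs → All (λ b → zeros b ∈ us) bs → Program us z →
                Program (unary bs ∷ us) (length bs * 2 + z)
unary-program {us} {z} bs bs∈ P =
  weaken (λ { (here refl) → here (spelled bs) ; (there u∈) → there u∈ })
    (≤-reflexive (cong (_+ z) (length-parts bs))) (extend P (avs bs∈))
  where
  parts : List ℕ → List (List (Fin 2))
  parts = concatMap (λ b → zeros b ∷ [ suc zero ] ∷ [])
  avs : ∀ {bs} → All (λ b → zeros b ∈ us) bs → All (Available us) (parts bs)
  avs []         = []
  avs (b∈ ∷ bs∈) = defined b∈ ∷ terminal (suc zero) ∷ avs bs∈
  spelled : ∀ bs → unary bs ≡ concat (parts bs)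
  spelled []       = refl
  spelled (b ∷ bs) = trans (++-assoc (zeros b) [ suc zero ] (unary bs))
    (cong (λ u → zeros b ++ suc zero ∷ u) (spelled bs))
  length-parts : ∀ bs → length (parts bs) ≡ length bs * 2
  length-parts []       = refl
  length-parts (b ∷ bs) = cong (2 +_) (length-parts bs)

∈⇒<unary : ∀ {b} bs → b ∈ bs → b < length (unary bs)
∈⇒<unary (b ∷ bs) b∈ = ≤-trans (go b∈) (≤-reflexive (sym (length-unary-∷ b bs)))
  where
  go : ∀ {c} → c ∈ b ∷ bs → c < suc b + length (unary bs)
  go (here refl) = m≤m+n (suc b) _
  go (there c∈)  = m≤n⇒m≤o+n (suc b) (∈⇒<unary bs c∈)

module _ (p T′ K : ℕ) (K≤2^v : K ≤ 2 ^ Construction.v p) where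

  open Construction p
  open Word T′ K K≤2^v

  -- Four powers cost `3 * L` each, the progression `2 * K`, and the start rule two symbols for each
  -- of the `3 + K` runs.
  small-grammar : ∀ N L (u : List⁺ (Fin 2)) → toList u ≡ unary (lengths N) →
                  1 ≤ K → length (toList u) < 2 ^ L →
                  g u ≤ 12 * L + 4 * K + 6
  small-grammar N L u eq 1≤K short =
    g≤program u (weaken (λ { (here refl) → here eq ; (there u∈) → there u∈ }) (≤-reflexive cost)
      (unary-program (lengths N) runs∈
        (progression (2 ^ v * G) G (there (there (here refl))) (there (there (there (here refl)))) K
          (power L E E< (power L M M< (power L (2 ^ v * G) A< (power L G G< empty-program)))))))
    where
    G E M : ℕ
    G = geometric w T
    E = evenPart h N
    M = oddPart h N
    fits : ∀ {b} → b ∈ lengths N → b < 2 ^ L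
    fits b∈ = <-trans (subst (_ <_) (cong length (sym eq)) (∈⇒<unary (lengths N) b∈)) short
    E< : E < 2 ^ L
    E< = fits (here refl)
    M< : M < 2 ^ L
    M< = fits (there (here refl))
    -- The first term of the progression is `code 0`, itself the length of a run of the word.
    A< : 2 ^ v * G < 2 ^ L
    A< = subst (_< 2 ^ L) (code-≡ 1≤K) (fits (there (there (there (∈-map⁺ code (∈-upTo⁺ 1≤K))))))
    G< : G < 2 ^ L
    G< = ≤-<-trans (m≤n*m G (2 ^ v) {{m^n≢0 2 v}}) A<
    us : List (List (Fin 2))
    us = zeros E ∷ zeros M ∷ zeros (2 ^ v * G) ∷ zeros G ∷ []
    chain : List (List (Fin 2))
    chain = map (λ i → zeros (i * G + 2 ^ v * G)) (downFrom K)
    code∈ : ∀ {i} → i ∈ upTo K → zeros (code i) ∈ chain ++ us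
    code∈ {i} i∈ = ∈-++⁺ˡ (subst (λ b → zeros b ∈ chain)
      (sym (trans (code-≡ (∈-upTo⁻ i∈)) (*-distribʳ-+ G i (2 ^ v))))
      (∈-map⁺ (λ i → zeros (i * G + 2 ^ v * G)) (∈-applyDownFrom⁺ id (∈-upTo⁻ i∈))))
    runs∈ : All (λ b → zeros b ∈ chain ++ us) (lengths N)
    runs∈ =
      ∈-++⁺ʳ chain (here refl) ∷
      ∈-++⁺ʳ chain (there (here refl)) ∷
      ∈-++⁺ʳ chain (there (here refl)) ∷
      All.tabulate λ b∈ → let i , i∈ , eq′ = ∈-map⁻ code b∈ in
        subst (λ b → zeros b ∈ chain ++ us) (sym eq′) (code∈ i∈)
    cost : length (lengths N) * 2 + (2 * K + (3 * L + (3 * L + (3 * L + (3 * L + 0))))) ≡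
           12 * L + 4 * K + 6
    cost = trans
      (cong (λ m → (3 + m) * 2 + (2 * K + (3 * L + (3 * L + (3 * L + (3 * L + 0))))))
            (trans (length-map code (upTo K)) (length-upTo K)))
      (collect K L)
      where
      collect : ∀ K L → (3 + K) * 2 + (2 * K + (3 * L + (3 * L + (3 * L + (3 * L + 0))))) ≡
                        12 * L + 4 * K + 6
      collect = solve-∀

-- Logarithms, lengths and ratios

2^⌊log₂⌋≤ : ∀ ℓ n → 1 ≤ n → ⌊log₂ n ⌋ ≡ ℓ → 2 ^ ℓ ≤ n
2^⌊log₂⌋≤ zero    n             1≤n eq = 1≤n
2^⌊log₂⌋≤ (suc ℓ) (suc zero)    1≤n eq = contradiction (trans (sym (⌊log₂[2^n]⌋≡n 0)) eq) λ ()
2^⌊log₂⌋≤ (suc ℓ) n@(suc (suc k)) 1≤n eq = begin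
  2 ^ ℓ + (2 ^ ℓ + 0)              ≡⟨ cong (2 ^ ℓ +_) (+-identityʳ (2 ^ ℓ)) ⟩
  2 ^ ℓ + 2 ^ ℓ                    ≤⟨ +-mono-≤ half half ⟩
  ⌊ n /2⌋ + ⌊ n /2⌋                ≤⟨ m≤n+m _ (lowBit n) ⟩
  lowBit n + (⌊ n /2⌋ + ⌊ n /2⌋)   ≡⟨ n≡lowBit+2⌊n/2⌋ n ⟨
  n                                ∎
  where
  open ≤-Reasoning
  half : 2 ^ ℓ ≤ ⌊ n /2⌋
  half = 2^⌊log₂⌋≤ ℓ ⌊ n /2⌋ (s≤s z≤n) (trans (⌊log₂⌊n/2⌋⌋≡⌊log₂n⌋∸1 n) (cong (_∸ 1) eq))

<2^1+⌊log₂⌋ : ∀ n → n < 2 ^ suc ⌊log₂ n ⌋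
<2^1+⌊log₂⌋ n = ≰⇒> λ le → <-irrefl refl
  (≤-trans (≤-reflexive (sym (⌊log₂[2^n]⌋≡n (suc ⌊log₂ n ⌋)))) (⌊log₂⌋-mono-≤ le))

1+n≤2^n : ∀ n → suc n ≤ 2 ^ n
1+n≤2^n zero    = ≤-refl
1+n≤2^n (suc n) = begin
  1 + suc n              ≤⟨ +-mono-≤ (m^n>0 2 n) (1+n≤2^n n) ⟩
  2 ^ n + 2 ^ n          ≡⟨ cong (2 ^ n +_) (+-identityʳ (2 ^ n)) ⟨
  2 ^ suc n              ∎
  where open ≤-Reasoning

value<2^ : ∀ βs → value βs 0 < 2 ^ length βs
value<2^ []       = ≤-refl
value<2^ (β ∷ βs) = begin
  suc (bit β + (value βs 0 + value βs 0))      ≤⟨ s≤s (+-monoˡ-≤ _ (bit≤1 β)) ⟩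
  suc (suc (value βs 0 + value βs 0))          ≡⟨ cong suc (+-suc (value βs 0) (value βs 0)) ⟨
  suc (value βs 0) + suc (value βs 0)          ≤⟨ +-mono-≤ (value<2^ βs) (value<2^ βs) ⟩
  2 ^ length βs + 2 ^ length βs                ≡⟨ cong (2 ^ length βs +_) (+-identityʳ _) ⟨
  2 ^ suc (length βs)                          ∎
  where open ≤-Reasoning

length-unary≤ : ∀ {m bs} → All (_< m) bs → length (unary bs) ≤ length bs * m
length-unary≤ [] = z≤n
length-unary≤ {m} {b ∷ bs} (b<m ∷ bs<m) =
  ≤-trans (≤-reflexive (length-unary-∷ b bs)) (+-mono-≤ b<m (length-unary≤ bs<m))

nonempty-unary : ∀ b bs → ∃ λ (u : List⁺ (Fin 2)) → toList u ≡ unary (b ∷ bs)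
nonempty-unary zero    bs = suc zero ∷ unary bs , refl
nonempty-unary (suc b) bs = zero ∷ _ , refl

∈-lists : ∀ {k} (xs : List (Fin k)) → xs ∈ lists k (length xs)
∈-lists []       = here refl
∈-lists (x ∷ xs) = ∈-cartesianProductWith⁺ _∷_ (∈-allFin x) (∈-lists xs)

∈-words : ∀ {k} (u : List⁺ (Fin k)) → u ∈ words k (length (toList u))
∈-words (x ∷ xs) = ∈-cartesianProductWith⁺ _∷_ (∈-allFin x) (∈-lists xs)

∈⇒≤foldr-⊔ : ∀ {q} qs → q ∈ qs → q ℚ.≤ foldr ℚ._⊔_ ℚ.0ℚ qs
∈⇒≤foldr-⊔ (q ∷ qs) (here refl) = ℚ.p≤p⊔q q _
∈⇒≤foldr-⊔ (q ∷ qs) (there q∈)  = ℚ.p≤q⇒p≤r⊔q q (∈⇒≤foldr-⊔ qs q∈)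

ratio≤α : ∀ C {k} (u : List⁺ (Fin k)) → ratio C u ℚ.≤ α C k (length (toList u))
ratio≤α C u = ∈⇒≤foldr-⊔ _ (∈-map⁺ (ratio C) (∈-words u))

1/c*a/b≤s/g : ∀ c a b s g .{{_ : NonZero c}} .{{_ : NonZero b}} .{{_ : NonZero g}} →
              a * g ≤ s * (c * b) → (ℤ.+ 1 ℚ./ c) ℚ.* (ℤ.+ a ℚ./ b) ℚ.≤ ℤ.+ s ℚ./ g
1/c*a/b≤s/g (suc c) a (suc b) s (suc g) h = ℚ.toℚᵘ-cancel-≤ (begin
  ℚ.toℚᵘ ((ℤ.+ 1 ℚ./ suc c) ℚ.* (ℤ.+ a ℚ./ suc b))
    ≃⟨ ℚ.toℚᵘ-homo-* (ℤ.+ 1 ℚ./ suc c) (ℤ.+ a ℚ./ suc b) ⟩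
  ℚ.toℚᵘ (ℤ.+ 1 ℚ./ suc c) ℚᵘ.* ℚ.toℚᵘ (ℤ.+ a ℚ./ suc b)
    ≃⟨ ℚᵘ.*-cong (ℚ.toℚᵘ-fromℚᵘ (ℚᵘ.mkℚᵘ (ℤ.+ 1) c)) (ℚ.toℚᵘ-fromℚᵘ (ℚᵘ.mkℚᵘ (ℤ.+ a) b)) ⟩
  ℚᵘ.mkℚᵘ (ℤ.+ 1) c ℚᵘ.* ℚᵘ.mkℚᵘ (ℤ.+ a) b
    ≤⟨ ℚᵘ.*≤* (subst₂ ℤ._≤_ left (ℤ.pos-* s (suc c * suc b)) (ℤ.+≤+ h)) ⟩
  ℚᵘ.mkℚᵘ (ℤ.+ s) g
    ≃⟨ ℚ.toℚᵘ-fromℚᵘ (ℚᵘ.mkℚᵘ (ℤ.+ s) g) ⟨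
  ℚ.toℚᵘ (ℤ.+ s ℚ./ suc g) ∎)
  where
  open ℚᵘ.≤-Reasoning
  left : ℤ.+ (a * suc g) ≡ ℤ.+ 1 ℤ.* ℤ.+ a ℤ.* ℤ.+ suc g
  left = trans (ℤ.pos-* a (suc g)) (cong (ℤ._* ℤ.+ suc g) (sym (ℤ.*-identityˡ (ℤ.+ a))))

log/loglog-≡ : ∀ n {d} → ⌊log₂ ⌊log₂ n ⌋ ⌋ ≡ suc d → log/loglog n ≡ ℤ.+ ⌊log₂ n ⌋ ℚ./ suc d
log/loglog-≡ n eq with ⌊log₂ ⌊log₂ n ⌋ ⌋ | eq
... | suc d | refl = refl

-- The choice of parameters

-- The coded runs take at most `K * 2 ^ J` letters, and more than `budget` copies of a nonterminal
-- deriving `2 ^ J` zeros have to fit into the padding.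
room : ∀ K J ℓ → 8 ≤ K → J ≤ K → 4 * K ≤ ℓ →
       3 + K * 2 ^ J + 2 ^ J * suc (J * (5 + K) + (5 + K)) ≤ 2 ^ ℓ
room K J ℓ 8≤K J≤K 4K≤ℓ = begin
  3 + K * 2 ^ J + 2 ^ J * suc (J * (5 + K) + (5 + K))
    ≤⟨ +-mono-≤ (+-mono-≤ (*-monoʳ-≤ 3 (m^n>0 2 K)) (*-monoʳ-≤ K 2^J≤2^K))
         (*-mono-≤ 2^J≤2^K (s≤s (+-monoˡ-≤ (5 + K) (*-monoˡ-≤ (5 + K) J≤K)))) ⟩
  3 * 2 ^ K + K * 2 ^ K + 2 ^ K * suc (K * (5 + K) + (5 + K))
    ≡⟨ collect K (2 ^ K) ⟩
  2 ^ K * (K * K + K * 7 + 9)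
    ≤⟨ *-monoʳ-≤ (2 ^ K) (+-mono-≤ (+-monoʳ-≤ (K * K) (*-monoʳ-≤ K (≤-trans (n≤1+n 7) 8≤K)))
                                   (≤-trans 9≤64 (*-mono-≤ 8≤K 8≤K))) ⟩
  2 ^ K * (K * K + K * K + K * K)
    ≡⟨ cong (2 ^ K *_) (triple K) ⟩
  2 ^ K * (3 * (K * K))
    -- Each of the factors 3, `K` and `K` is at most `2 ^ K`, which gives the exponent `4 * K`.
    ≤⟨ *-monoʳ-≤ (2 ^ K) (*-mono-≤ (≤-trans 3≤8 (≤-trans 8≤K K≤2^K)) (*-mono-≤ K≤2^K K≤2^K)) ⟩
  2 ^ K * (2 ^ K * (2 ^ K * 2 ^ K))
    ≡⟨ trans (cong (λ x → 2 ^ K * (2 ^ K * x)) (sym (^-distribˡ-+-* 2 K K)))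
         (trans (cong (2 ^ K *_) (sym (^-distribˡ-+-* 2 K (K + K))))
           (sym (^-distribˡ-+-* 2 K (K + (K + K))))) ⟩
  2 ^ (K + (K + (K + K)))
    ≡⟨ cong (2 ^_) (quadruple K) ⟩
  2 ^ (4 * K)
    ≤⟨ ^-monoʳ-≤ 2 4K≤ℓ ⟩
  2 ^ ℓ ∎
  where
  open ≤-Reasoning
  2^J≤2^K : 2 ^ J ≤ 2 ^ K
  2^J≤2^K = ^-monoʳ-≤ 2 J≤K
  K≤2^K : K ≤ 2 ^ K
  K≤2^K = <⇒≤ (1+n≤2^n K)
  9≤64 : 9 ≤ 64
  9≤64 = m≤m+n 9 55
  3≤8 : 3 ≤ 8
  3≤8 = m≤m+n 3 5
  collect : ∀ K x → 3 * x + K * x + x * (1 + (K * (5 + K) + (5 + K))) ≡ x * (K * K + K * 7 + 9)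
  collect = solve-∀
  triple : ∀ K → K * K + K * K + K * K ≡ 3 * (K * K)
  triple = solve-∀
  quadruple : ∀ K → K + (K + (K + K)) ≡ 4 * K
  quadruple = solve-∀

module _ (p T′ K : ℕ) (K≤2^v : K ≤ 2 ^ Construction.v p) where

  open Construction p
  open Word T′ K K≤2^v

  length-codes : length (unary (map code (upTo K))) ≤ K * 2 ^ J
  length-codes = ≤-trans (length-unary≤ (All.tabulate code<))
    (≤-reflexive (cong (_* 2 ^ J) (trans (length-map code (upTo K)) (length-upTo K))))
    where
    code< : ∀ {b} → b ∈ map code (upTo K) → b < 2 ^ J
    code< b∈ with i , _ , refl ← ∈-map⁻ code b∈ = subst (λ m → code i < 2 ^ m)
      (trans (length-repeat T (block i)) (cong (T *_) (length-block i))) (value<2^ (repeat T (block i)))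

  length-lengths : ∀ N → length (unary (lengths N)) ≡ 3 + length (unary (map code (upTo K))) + N
  length-lengths N = begin
    length (unary (lengths N))
      ≡⟨ trans (length-unary-∷ E (M ∷ M ∷ codes)) (cong (suc E +_)
           (trans (length-unary-∷ M (M ∷ codes)) (cong (suc M +_) (length-unary-∷ M codes)))) ⟩
    suc E + (suc M + (suc M + C))    ≡⟨ shuffle E M C ⟩
    3 + C + (E + (M + M))            ≡⟨ cong (3 + C +_) (evenPart+2oddPart h N) ⟩
    3 + C + N                        ∎
    where
    open ≡-Reasoning
    codes : List ℕ
    codes = map code (upTo K)
    E M C : ℕ
    E = evenPart h N
    M = oddPart h N
    C = length (unary codes)
    shuffle : ∀ E M C → (1 + E) + ((1 + M) + ((1 + M) + C)) ≡ 3 + C + (E + (M + M))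
    shuffle = solve-∀

  hard-word : ∀ n ℓ → 8 ≤ K → J ≤ K → 4 * K ≤ ℓ → 2 ^ ℓ ≤ n →
              ∃₂ λ N (u : List⁺ (Fin 2)) →
                toList u ≡ unary (lengths N) × length (toList u) ≡ n × budget < ⌊ N /4^ h ⌋
  hard-word n ℓ 8≤K J≤K 4K≤ℓ 2^ℓ≤n =
    N , proj₁ u , proj₂ u ,
    trans (cong length (proj₂ u)) (trans (length-lengths N) (m+[n∸m]≡n {3 + C} {n} A≤n)) ,
    ≤⌊/4^⌋ h enough
    where
    C N : ℕ
    C = length (unary (map code (upTo K)))
    -- What remains of `n` after the coded runs and the letters 1 that end the three padding runs.
    N = n ∸ (3 + C)
    u : ∃ λ (u : List⁺ (Fin 2)) → toList u ≡ unary (lengths N)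
    u = nonempty-unary (evenPart h N) (oddPart h N ∷ oddPart h N ∷ map code (upTo K))
    fits : 3 + C + 2 ^ J * suc budget ≤ n
    fits = ≤-trans (+-monoˡ-≤ (2 ^ J * suc budget) (+-monoʳ-≤ 3 length-codes))
      (≤-trans (room K J ℓ 8≤K J≤K 4K≤ℓ) 2^ℓ≤n)
    A≤n : 3 + C ≤ n
    A≤n = m+n≤o⇒m≤o (3 + C) fits
    enough : 2 ^ (h * 2) * suc budget ≤ N
    enough = subst (λ j → 2 ^ j * suc budget ≤ N) (sym h*2≡J)
      (m+n≤o⇒m≤o∸n (2 ^ J * suc budget) (subst (_≤ n) (+-comm (3 + C) (2 ^ J * suc budget)) fits))

2^≤⇒≤⌊log₂⌋ : ∀ k {n} → 2 ^ k ≤ n → k ≤ ⌊log₂ n ⌋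
2^≤⇒≤⌊log₂⌋ k le = ≤-trans (≤-reflexive (sym (⌊log₂[2^n]⌋≡n k))) (⌊log₂⌋-mono-≤ le)

-- Eliminates `K` and `T`: one of the two factors `K` in the bound on `ℓ * g` is traded for `T * d`,
-- and `K * T` is at most twice the output size.
cross-multiplied : ∀ a b c {K T ℓ d s g} → K * T ≤ s * 2 → g ≤ b * K → ℓ ≤ a * K → K ≤ c * (T * d) →
                   ℓ * g ≤ s * (2 * (a * b * c) * d)
cross-multiplied a b c {K} {T} {ℓ} {d} {s} {g} KT≤ g≤ ℓ≤ K≤ = begin
  ℓ * g                         ≤⟨ *-mono-≤ ℓ≤ g≤ ⟩
  a * K * (b * K)               ≡⟨ square a b K ⟩
  K * (a * b * K)               ≤⟨ *-monoʳ-≤ K (*-monoʳ-≤ (a * b) K≤) ⟩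
  K * (a * b * (c * (T * d)))   ≡⟨ regroup (a * b) c K T d ⟩
  K * T * (a * b * c * d)       ≤⟨ *-monoˡ-≤ (a * b * c * d) KT≤ ⟩
  s * 2 * (a * b * c * d)       ≡⟨ merge (a * b * c) s d ⟩
  s * (2 * (a * b * c) * d)     ∎
  where
  open ≤-Reasoning
  square : ∀ a b K → a * K * (b * K) ≡ K * (a * b * K)
  square = solve-∀
  regroup : ∀ a b K T d → K * (a * (b * (T * d))) ≡ K * T * (a * b * d)
  regroup = solve-∀
  merge : ∀ b s d → s * 2 * (b * d) ≡ s * (2 * b * d)
  merge = solve-∀

module _ {τ : TieBreaking} {RePair : Compressor} (isRePair : IsRePair τ RePair) where

  -- With `K = 2 ^ (1 + p)` the hypotheses on `⌊log₂ n ⌋` say that it lies between `4 * K` and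
  -- `8 * K`.
  bound : ∀ p n → 2 ≤ p → 2 ^ ⌊log₂ n ⌋ ≤ n → 2 ^ (3 + p) ≤ ⌊log₂ n ⌋ → ⌊log₂ n ⌋ < 2 ^ (4 + p) →
          (ℤ.+ 1 ℚ./ 6464) ℚ.* (ℤ.+ ⌊log₂ n ⌋ ℚ./ (3 + p)) ℚ.≤ α RePair 2 n
  bound p n 2≤p 2^ℓ≤n 2^d≤ℓ ℓ<2^1+d =
    let N , u , eq , length≡n , enough = hard-word p T′ K K≤2^v n ℓ 8≤K J≤K 4K≤ℓ 2^ℓ≤n in
    ℚ.≤-trans
      (1/c*a/b≤s/g 6464 ℓ (3 + p) ∣ compress RePair u ∣ (g u) {{_}} {{_}} {{g-nonZero u}}
        (cross-multiplied 8 101 4 {K} {T} {d = 3 + p} {s = ∣ compress RePair u ∣}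
          (large-output τ N u eq enough (isRePair u)) (small N u eq length≡n) (<⇒≤ ℓ<8K) K≤4Td))
      (subst (λ m → ratio RePair u ℚ.≤ α RePair 2 m) length≡n (ratio≤α RePair u))
    where
    open Construction p using (v; w)
    ℓ K T′ : ℕ
    ℓ  = ⌊log₂ n ⌋
    K  = 2 ^ suc p
    -- `T = K / w` is the largest number of blocks with `J ≤ K`; it is positive because `w ≤ K`.
    T′ = pred (K / w)
    K≤2^v : K ≤ 2 ^ v
    K≤2^v = ^-monoʳ-≤ 2 (s≤s (m≤n*m p 2))
    open Construction.Word p T′ K K≤2^v
    8≤K : 8 ≤ K
    8≤K = ^-monoʳ-≤ 2 {3} {suc p} (s≤s 2≤p)
    w≤K : w ≤ K
    w≤K = ≤-trans (≤-reflexive (Construction.w≡2[1+p] p)) (*-monoʳ-≤ 2 (1+n≤2^n p))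
    T≡K/w : T ≡ K / w
    T≡K/w = suc-pred (K / w) {{>-nonZero (m≥n⇒m/n>0 w≤K)}}
    J≤K : J ≤ K
    J≤K = ≤-trans (≤-reflexive (cong (_* w) T≡K/w)) (m/n*n≤m K w)
    4K≤ℓ : 4 * K ≤ ℓ
    4K≤ℓ = ≤-trans (≤-reflexive (*-assoc 2 2 K)) 2^d≤ℓ
    ℓ<8K : ℓ < 8 * K
    ℓ<8K = ≤-trans ℓ<2^1+d (≤-reflexive (sym (trans (*-assoc 2 4 K) (cong (2 *_) (*-assoc 2 2 K)))))
    -- With `suc ℓ ≤ 8 * K` and `6 ≤ K`, the constant is 12 · 8 + 4 + 1 = 101.
    small : ∀ N u → toList u ≡ unary (lengths N) → length (toList u) ≡ n → g u ≤ 101 * K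
    small N u eq length≡n = begin
      g u
        ≤⟨ small-grammar p T′ K K≤2^v N (suc ℓ) u eq (≤-trans (s≤s z≤n) 8≤K)
             (subst (_< 2 ^ suc ℓ) (sym length≡n) (<2^1+⌊log₂⌋ n)) ⟩
      12 * suc ℓ + 4 * K + 6
        ≤⟨ +-mono-≤ (+-monoˡ-≤ (4 * K) (*-monoʳ-≤ 12 ℓ<8K)) (≤-trans (m≤m+n 6 2) 8≤K) ⟩
      12 * (8 * K) + 4 * K + K
        ≡⟨ collect 12 8 4 K ⟩
      (12 * 8 + 4 + 1) * K ∎
      where
      open ≤-Reasoning
      collect : ∀ a b c K → a * (b * K) + c * K + K ≡ (a * b + c + 1) * K
      collect = solve-∀
    -- Rounding in `K / w` loses at most a factor 2 as `T` is positive, and `w = 2 * (1 + p)` is at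
    -- most `2 * d`.
    K≤4Td : K ≤ 4 * (T * (3 + p))
    K≤4Td = begin
      K                          ≡⟨ m≡m%n+[m/n]*n K w ⟩
      K % w + K / w * w          ≤⟨ +-monoˡ-≤ (K / w * w) (<⇒≤ (m%n<n K w)) ⟩
      w + K / w * w              ≡⟨ cong (λ t → w + t * w) T≡K/w ⟨
      w + T * w                  ≤⟨ +-monoˡ-≤ (T * w) (m≤n*m w T) ⟩
      T * w + T * w              ≤⟨ +-mono-≤ (*-monoʳ-≤ T w≤2d) (*-monoʳ-≤ T w≤2d) ⟩
      T * (2 * d) + T * (2 * d)  ≡⟨ collect T d ⟩
      4 * (T * d)                ∎
      where
      open ≤-Reasoning
      d : ℕ
      d = 3 + p
      w≤2d : w ≤ 2 * d
      w≤2d = ≤-trans (≤-reflexive (Construction.w≡2[1+p] p)) (*-monoʳ-≤ 2 (m≤n+m (suc p) 2))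
      collect : ∀ T d → T * (2 * d) + T * (2 * d) ≡ 4 * (T * d)
      collect = solve-∀

-- With K = 2 ^ (1 + p), ℓ < 8 K and d = 3 + p, RePair's K T / 2 competes with
-- a grammar of size 101 K, where K ≤ 4 T d; the constant is 6464 = 2 · 8 · 101 · 4.
theorem3p7 : (τ : TieBreaking) (RePair : Compressor) → IsRePair τ RePair →
    α RePair 2 ∈Ω log/loglog
theorem3p7 τ RePair isRePair =
  -- The threshold makes the iterated logarithm at least 5, hence `2 ≤ p` and `8 ≤ K`, as `room`
  -- requires.
  ℤ.+ 1 ℚ./ 6464 , ℚ.positive⁻¹ (ℤ.+ 1 ℚ./ 6464) {{ℚ.normalize-pos 1 6464}} , 2 ^ (2 ^ 5) , large
  where
  large : ∀ n → 2 ^ (2 ^ 5) ≤ n → (ℤ.+ 1 ℚ./ 6464) ℚ.* log/loglog n ℚ.≤ α RePair 2 n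
  large n 2^32≤n = subst (λ q → (ℤ.+ 1 ℚ./ 6464) ℚ.* q ℚ.≤ α RePair 2 n) (sym (log/loglog-≡ n d≡3+p))
    (bound {τ} {RePair} isRePair p n 2≤p (2^⌊log₂⌋≤ ℓ n 1≤n refl)
      (subst (λ d → 2 ^ d ≤ ℓ) d≡3+p (2^⌊log₂⌋≤ d ℓ 1≤ℓ refl))
      (subst (λ d → ℓ < 2 ^ suc d) d≡3+p (<2^1+⌊log₂⌋ ℓ)))
    where
    ℓ d p : ℕ
    ℓ = ⌊log₂ n ⌋
    d = ⌊log₂ ℓ ⌋
    p = d ∸ 3
    1≤n : 1 ≤ n
    1≤n = ≤-trans (m^n>0 2 (2 ^ 5)) 2^32≤n
    2^5≤ℓ : 2 ^ 5 ≤ ℓ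
    2^5≤ℓ = 2^≤⇒≤⌊log₂⌋ (2 ^ 5) 2^32≤n
    1≤ℓ : 1 ≤ ℓ
    1≤ℓ = ≤-trans (m^n>0 2 5) 2^5≤ℓ
    5≤d : 5 ≤ d
    5≤d = 2^≤⇒≤⌊log₂⌋ 5 2^5≤ℓ
    d≡3+p : d ≡ 3 + p
    d≡3+p = sym (m+[n∸m]≡n (≤-trans (m≤m+n 3 2) 5≤d))
    2≤p : 2 ≤ p
    2≤p = ∸-monoˡ-≤ 3 5≤d
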